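{- Let $\mathcal{G}_1$ be an $r_1$-regular graph on $n_1$ vertices and $\mathcal{G}_2$ an $r_2$-regular graph on $n_2$ vertices. Let $\mu_{11},\mu_{12},\ldots,\mu_{1n_1}$ be the Laplacian eigenvalues of $\mathcal{G}_1$. Then the Laplacian characteristic polynomial of $\mathcal{G}_1\circledast\mathcal{G}_2$ satisfies $$f(L_{\mathcal{G}_1\circledast \mathcal{G}_2},x)=(x-r_1n_2-n_2)^{n_1(n_2-1)}\, f(L_{\mathcal{G}_2},x-n_2)^{n_1}\cdot \prod_{i=1}^{n_1}\big[x-n_2-n_2\mu_{1i}-n_2\chi_{L_{\mathcal{G}_2}}(x-n_2)\big].$$
   Context: All graphs are simple, finite and undirected. For a graph $\mathcal{G}$ with adjacency matrix $A_{\mathcal{G}}$ and diagonal degree matrix $D_{\mathcal{G}}$, the Laplacian matrix is $L_{\mathcal{G}}=D_{\mathcal{G}}-A_{\mathcal{G}}$. For a square matrix $M$ of order $n$, $f(M,x)=\det(xI_n-M)$ is its characteristic polynomial. The Laplacian coronal of a graph $\mathcal{G}$ on $n$ vertices is the rational function $\chi_{L_{\mathcal{G}}}(x)=\mathbf{1}_n^T(xI_n-L_{\mathcal{G}})^{ -1}\mathbf{1}_n$, where $\mathbf{1}_n$ is the all-ones column vector. The graph product $\mathcal{G}_1\circledast\mathcal{G}_2$ of $\mathcal{G}_1$ (vertices $u_1,\ldots,u_{n_1}$) and $\mathcal{G}_2$ (vertices $v_1,\ldots,v_{n_2}$) has vertex set $\{a_{ik},b_{ik}:1\le i\le n_1,1\le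 k\le n_2\}$ ($2n_1n_2$ vertices) and edges: (1) $a_{ik}a_{jl}$ for all $1\le k,l\le n_2$ whenever $u_iu_j\in E(\mathcal{G}_1)$; (2) $b_{ri}b_{rj}$ for all $1\le r\le n_1$ whenever $v_iv_j\in E(\mathcal{G}_2)$; (3) $a_{ip}b_{iq}$ for all $1\le i\le n_1$ and $1\le p,q\le n_2$. The identity is an identity of rational functions in $x$. -}

module Defs where

open import Algebra.Apartness.Bundles using (HeytingField; HeytingCommutativeRing)
open import Algebra.Bundles using (CommutativeRing)
open import Algebra.Bundles.Raw using (RawRing)
import Algebra.Apartness.Properties.HeytingCommutativeRing as HeytingProperties
import Algebra.Definitions
import Algebra.Definitions.RawMonoid
import Algebra.Definitions.RawSemiring
open import Data.Bool.Base using (if_then_else_)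
open import Data.Fin.Base using (Fin; zero; suc; toℕ; punchIn; splitAt; remQuot)
open import Data.Fin.Properties using (_≟_)
open import Data.List.Base using (List; []; _∷_; map)
open import Data.Nat.Base as ℕ using (ℕ; zero; suc; NonZero; s≤s)
import Data.Nat.Properties as ℕ
open import Data.Product.Base using (_,_; proj₁; proj₂; uncurry)
open import Data.Sum.Base using ([_,_]′)
open import Data.Vec.Functional using (Vector)
open import Level using (Level; 0ℓ; _⊔_)
open import Relation.Binary.Core using (Rel)
open import Relation.Binary.Definitions using (Decidable; Symmetric; Irreflexive)
open import Relation.Binary.PropositionalEquality using (_≡_; refl)
open import Relation.Nullary.Decidable using (yes; no; does; map′)
open import Relation.Nullary.Negation using (¬_)

private
  variable
    c ℓ₁ ℓ₂ : Level
    m n : ℕ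

record Graph (n : ℕ) : Set₁ where
  field
    E      : Rel (Fin n) 0ℓ
    E?     : Decidable E
    sym    : Symmetric E
    irrefl : Irreflexive _≡_ E

  degree : Fin n → ℕ
  degree i = sum λ j → if does (E? i j) then 1 else 0
    where open Algebra.Definitions.RawMonoid ℕ.+-0-rawMonoid using (sum)

Regular : ℕ → Graph n → Set
Regular r G = ∀ i → Graph.degree G i ≡ r

data Vertex (m n : ℕ) : Set where
  a b : Fin m → Fin n → Vertex m n

module _ (G₁ : Graph m) (G₂ : Graph n) where
  private
    module G₁ = Graph G₁
    module G₂ = Graph G₂

  data Edge : Rel (Vertex m n) 0ℓ where
    aa : ∀ {i j k l} → G₁.E i j → Edge (a i k) (a j l)
    bb : ∀ {r i j}   → G₂.E i j → Edge (b r i) (b r j)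
    ab : ∀ {i p q}   → Edge (a i p) (b i q)
    ba : ∀ {i p q}   → Edge (b i q) (a i p)

  edge? : Decidable Edge
  edge? (a i k) (a j l) = map′ aa (λ { (aa e) → e }) (G₁.E? i j)
  edge? (a i p) (b j q) = map′ (λ { refl → ab }) (λ { ab → refl }) (i ≟ j)
  edge? (b i q) (a j p) = map′ (λ { refl → ba }) (λ { ba → refl }) (i ≟ j)
  edge? (b r i) (b s j) with r ≟ s
  ... | yes refl = map′ bb (λ { (bb e) → e }) (G₂.E? i j)
  ... | no  r≢s  = no λ { (bb _) → r≢s refl }

  edge-sym : Symmetric Edge
  edge-sym (aa e) = aa (G₁.sym e)
  edge-sym (bb e) = bb (G₂.sym e)
  edge-sym ab     = ba
  edge-sym ba     = ab

  edge-irrefl : Irreflexive _≡_ Edge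
  edge-irrefl refl (aa e) = G₁.irrefl refl e
  edge-irrefl refl (bb e) = G₂.irrefl refl e

-- The bijection numbering the vertices: the a's come first, then the b's.
vertex : Fin (m ℕ.* n ℕ.+ m ℕ.* n) → Vertex m n
vertex {m} {n} v =
  [ (λ u → uncurry a (remQuot n u)) , (λ u → uncurry b (remQuot n u)) ]′ (splitAt (m ℕ.* n) v)

infixl 7 _⊛_

_⊛_ : Graph m → Graph n → Graph (m ℕ.* n ℕ.+ m ℕ.* n)
G₁ ⊛ G₂ = record
  { E      = λ u v → Edge G₁ G₂ (vertex u) (vertex v)
  ; E?     = λ u v → edge? G₁ G₂ (vertex u) (vertex v)
  ; sym    = edge-sym G₁ G₂
  ; irrefl = λ { refl → edge-irrefl G₁ G₂ refl }
  }

module Matrices (R : RawRing c ℓ₁) where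
  open RawRing R public
  open Algebra.Definitions.RawSemiring rawSemiring public
    using (_×_; _^_; sum; product)

  infixl 6 _-_ _-ᴹ_
  infixl 7 _*ᴹ_
  infix  4 _≈ᴹ_

  _-_ : Carrier → Carrier → Carrier
  x - y = x + (- y)

  nat : ℕ → Carrier
  nat k = k × 1#

  Matrix : ℕ → Set c
  Matrix n = Fin n → Fin n → Carrier

  _≈ᴹ_ : Rel (Matrix n) ℓ₁
  M ≈ᴹ N = ∀ i j → M i j ≈ N i j

  _-ᴹ_ _*ᴹ_ : Matrix n → Matrix n → Matrix n
  (M -ᴹ N) i j = M i j - N i j
  (M *ᴹ N) i j = sum λ k → M i k * N k j

  diagonal : Vector Carrier n → Matrix n
  diagonal d i j = if does (i ≟ j) then d i else 0#

  scalar : Carrier → Matrix n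
  scalar t = diagonal λ _ → t

  -- Laplace expansion along the first row.
  det : Matrix n → Carrier
  det {zero}  M = 1#
  det {suc n} M = sum λ j →
    (- 1#) ^ toℕ j * (M zero j * det λ i k → M (suc i) (punchIn j k))

  -- f M is evaluated at arbitrary ring elements t; taking t to be the
  -- indeterminate of a polynomial ring gives the characteristic polynomial.
  f : Matrix n → Carrier → Carrier
  f M t = det (scalar t -ᴹ M)

  adjacency degrees laplacian : Graph n → Matrix n
  adjacency G i j = if does (Graph.E? G i j) then 1# else 0#
  degrees   G     = diagonal λ i → nat (Graph.degree G i)
  laplacian G     = degrees G -ᴹ adjacency G

  Invertibleᴹ : Matrix n → Set (c ⊔ ℓ₁)
  Invertibleᴹ = Algebra.Definitions.Invertible _≈ᴹ_ (scalar 1#) _*ᴹ_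

  -- 1ᵀ (t I - L)⁻¹ 1: the sum of all entries of the (unique) inverse.
  coronal : (G : Graph n) (t : Carrier) → Invertibleᴹ (scalar t -ᴹ laplacian G) → Carrier
  coronal G t (N , _) = sum λ i → sum λ j → N i j

-- Heyting fields spare us decidability of equality, which the constructive
-- reals lack; classically they are exactly the fields.
module RationalFunctions (K : HeytingField c ℓ₁ ℓ₂) where
  private
    module K where
      open HeytingField K public
      open HeytingProperties heytingCommutativeRing public
        using (1#0; x-0≈x)

  -- Coefficient lists, constant term first.
  Poly : Set c
  Poly = List K.Carrier

  coeff : Poly → ℕ → K.Carrier
  coeff []      _       = K.0#
  coeff (x ∷ p) zero    = x
  coeff (x ∷ p) (suc k) = coeff p k

  infix  4 _≈ᴾ_ _≉ᴾ_
  infixl 6 _+ᴾ_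
  infixl 7 _*ᴾ_

  -- Trailing zero coefficients are ignored.  A record, so that p and q can
  -- be inferred from a proof.
  record _≈ᴾ_ (p q : Poly) : Set ℓ₁ where
    constructor coeffwise
    field
      coeff≈ : ∀ k → coeff p k K.≈ coeff q k

  open _≈ᴾ_ public

  _≉ᴾ_ : Rel Poly ℓ₁
  p ≉ᴾ q = ¬ (p ≈ᴾ q)

  _+ᴾ_ _*ᴾ_ : Poly → Poly → Poly
  []      +ᴾ q       = q
  (x ∷ p) +ᴾ []      = x ∷ p
  (x ∷ p) +ᴾ (y ∷ q) = x K.+ y ∷ p +ᴾ q
  []      *ᴾ q = []
  (x ∷ p) *ᴾ q = map (x K.*_) q +ᴾ (K.0# ∷ p *ᴾ q)

  -ᴾ_ : Poly → Poly
  -ᴾ_ = map λ y → K.- y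

  constᴾ : K.Carrier → Poly
  constᴾ x = x ∷ []

  X : Poly
  X = K.0# ∷ K.1# ∷ []

  K[X] : RawRing c ℓ₁
  K[X] = record
    { Carrier = Poly
    ; _≈_     = _≈ᴾ_
    ; _+_     = _+ᴾ_
    ; _*_     = _*ᴾ_
    ; -_      = -ᴾ_
    ; 0#      = []
    ; 1#      = constᴾ K.1#
    }

  private
    open import Relation.Binary.Reasoning.Setoid K.setoid

    coeff-+ : ∀ p q k → coeff (p +ᴾ q) k K.≈ coeff p k K.+ coeff q k
    coeff-+ []      q       k       = K.sym (K.+-identityˡ _)
    coeff-+ (x ∷ p) []      k       = K.sym (K.+-identityʳ _)
    coeff-+ (x ∷ p) (y ∷ q) zero    = K.refl
    coeff-+ (x ∷ p) (y ∷ q) (suc k) = coeff-+ p q k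

    coeff-map : ∀ x q k → coeff (map (x K.*_) q) k K.≈ x K.* coeff q k
    coeff-map x []      k       = K.sym (K.zeroʳ x)
    coeff-map x (y ∷ q) zero    = K.refl
    coeff-map x (y ∷ q) (suc k) = coeff-map x q k

    coeff-* : ∀ x p q k →
      coeff ((x ∷ p) *ᴾ q) k K.≈ x K.* coeff q k K.+ coeff (K.0# ∷ p *ᴾ q) k
    coeff-* x p q k = K.trans (coeff-+ (map (x K.*_) q) _ k) (K.+-congʳ (coeff-map x q k))

    x*0+0≈0 : ∀ x {y z} → y K.≈ K.0# → z K.≈ K.0# → x K.* y K.+ z K.≈ K.0#
    x*0+0≈0 x {y} {z} y≈0 z≈0 = begin
      x K.* y K.+ z       ≈⟨ K.+-cong (K.*-congˡ y≈0) z≈0 ⟩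
      x K.* K.0# K.+ K.0# ≈⟨ K.+-identityʳ _ ⟩
      x K.* K.0#          ≈⟨ K.zeroʳ x ⟩
      K.0#                ∎

    Low : ℕ → Poly → Set ℓ₁
    Low k p = ∀ j → j ℕ.< k → coeff p j K.≈ K.0#

    low-* : ∀ {k} p q → Low k q → Low k (p *ᴾ q)
    low-shift : ∀ {k} p q → Low k q → Low (suc k) (K.0# ∷ p *ᴾ q)

    low-* []      q low j j<k = K.refl
    low-* (x ∷ p) q low j j<k = K.trans (coeff-* x p q j)
      (x*0+0≈0 x (low j j<k) (low-shift p q low j (ℕ.m<n⇒m<1+n j<k)))

    low-shift p q low zero    _         = K.refl
    low-shift p q low (suc j) (s≤s j<k) = low-* p q low j j<k

    #-cancel : ∀ {x y} → x K.# K.0# → x K.* y K.≈ K.0# → y K.≈ K.0#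
    #-cancel {x} {y} x#0 xy≈0 with K.#⇒invertible x#0
    ... | x⁻¹ , inverseˡ , _ = begin
      y                          ≈⟨ K.*-identityˡ y ⟨
      K.1# K.* y                 ≈⟨ K.*-congʳ inverseˡ ⟨
      x⁻¹ K.* (x K.- K.0#) K.* y ≈⟨ K.*-congʳ (K.*-congˡ (K.x-0≈x x)) ⟩
      x⁻¹ K.* x K.* y            ≈⟨ K.*-assoc x⁻¹ x y ⟩
      x⁻¹ K.* (x K.* y)          ≈⟨ K.*-congˡ xy≈0 ⟩
      x⁻¹ K.* K.0#               ≈⟨ K.zeroʳ x⁻¹ ⟩
      K.0#                       ∎

    low-all : ∀ {x} p q → x K.# K.0# → (x ∷ p) *ᴾ q ≈ᴾ [] → ∀ k → Low k q
    low-all p q x#0 eq (suc k) j (s≤s j≤k) = #-cancel x#0 (begin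
      _ K.* coeff q j                               ≈⟨ K.+-identityʳ _ ⟨
      _ K.* coeff q j K.+ K.0#                      ≈⟨ K.+-congˡ (low-shift p q (low-all p q x#0 eq k) j (s≤s j≤k)) ⟨
      _ K.* coeff q j K.+ coeff (K.0# ∷ p *ᴾ q) j   ≈⟨ coeff-* _ p q j ⟨
      coeff ((_ ∷ p) *ᴾ q) j                        ≈⟨ coeff≈ eq j ⟩
      K.0#                                          ∎)

  *ᴾ-cancelʳ : ∀ p q → q ≉ᴾ [] → p *ᴾ q ≈ᴾ [] → p ≈ᴾ []
  *ᴾ-cancelʳ []      q q≉0 pq≈0 = coeffwise λ _ → K.refl
  *ᴾ-cancelʳ (x ∷ p) q q≉0 pq≈0 = coeffwise λ where
      zero    → x≈0
      (suc k) → coeff≈ (*ᴾ-cancelʳ p q q≉0 tail≈0) k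
    where
    x≈0 : x K.≈ K.0#
    x≈0 = proj₁ (K.tight x K.0#) λ x#0 →
      q≉0 (coeffwise λ k → low-all p q x#0 pq≈0 (suc k) k (ℕ.n<1+n k))

    tail≈0 : p *ᴾ q ≈ᴾ []
    tail≈0 = coeffwise λ k → begin
      coeff (p *ᴾ q) k                                   ≈⟨ K.+-identityˡ _ ⟨
      K.0# K.+ coeff (p *ᴾ q) k                          ≈⟨ K.+-congʳ (K.zeroˡ _) ⟨
      K.0# K.* coeff q (suc k) K.+ coeff (p *ᴾ q) k      ≈⟨ K.+-congʳ (K.*-congʳ x≈0) ⟨
      x K.* coeff q (suc k) K.+ coeff (p *ᴾ q) k         ≈⟨ coeff-* x p q (suc k) ⟨
      coeff ((x ∷ p) *ᴾ q) (suc k)                       ≈⟨ coeff≈ pq≈0 (suc k) ⟩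
      K.0#                                               ∎

  *ᴾ-nonZero : ∀ p q → p ≉ᴾ [] → q ≉ᴾ [] → p *ᴾ q ≉ᴾ []
  *ᴾ-nonZero p q p≉0 q≉0 pq≈0 = p≉0 (*ᴾ-cancelʳ p q q≉0 pq≈0)

  1≉0 : constᴾ K.1# ≉ᴾ []
  1≉0 1≈0 = proj₂ (K.tight K.1# K.0#) (coeff≈ 1≈0 zero) K.1#0

  record Fraction : Set (c ⊔ ℓ₁) where
    constructor _/_[_]
    field
      num  : Poly
      den  : Poly
      den≉0 : den ≉ᴾ []

  open Fraction public

  fromPoly : Poly → Fraction
  fromPoly p = p / constᴾ K.1# [ 1≉0 ]

  infix 4 _≈ᶠ_

  record _≈ᶠ_ (u v : Fraction) : Set ℓ₁ where
    constructor cross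
    field
      cross≈ : num u *ᴾ den v ≈ᴾ num v *ᴾ den u

  open _≈ᶠ_ public

  K⟨X⟩ : RawRing (c ⊔ ℓ₁) ℓ₁
  K⟨X⟩ = record
    { Carrier = Fraction
    ; _≈_     = _≈ᶠ_
    ; _+_     = λ u v → (num u *ᴾ den v +ᴾ num v *ᴾ den u) / (den u *ᴾ den v)
                          [ *ᴾ-nonZero (den u) (den v) (den≉0 u) (den≉0 v) ]
    ; _*_     = λ u v → (num u *ᴾ num v) / (den u *ᴾ den v)
                          [ *ᴾ-nonZero (den u) (den v) (den≉0 u) (den≉0 v) ]
    ; -_      = λ u → (-ᴾ num u) / den u [ den≉0 u ]
    ; 0#      = fromPoly []
    ; 1#      = fromPoly (constᴾ K.1#)
    }

  const : K.Carrier → Fraction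
  const y = fromPoly (constᴾ y)

  x : Fraction
  x = fromPoly X

CharacteristicZero : HeytingField c ℓ₁ ℓ₂ → Set ℓ₂
CharacteristicZero K = ∀ k → .{{NonZero k}} → (k × 1#) # 0#
  where
  open HeytingField K
  open CommutativeRing
    (HeytingCommutativeRing.commutativeRing heytingCommutativeRing) using (+-rawMonoid)
  open Algebra.Definitions.RawMonoid +-rawMonoid using (_×_)

-- μ lists the Laplacian eigenvalues of G with multiplicity: they are the
-- roots of the characteristic polynomial, which splits over K.
LaplacianEigenvalues : (K : HeytingField c ℓ₁ ℓ₂) → Graph n →
                       Vector (HeytingField.Carrier K) n → Set ℓ₁
LaplacianEigenvalues K G μ = f (laplacian G) X ≈ product λ i → X - constᴾ (μ i)
  where
  open RationalFunctions K
  open Matrices K[X]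

{-# OPTIONS --safe #-}
module Submission where

-- Write L₂ for the Laplacian matrix of G₂, A₁ for the adjacency matrix of G₁, J
-- for the all-ones matrix of order n₂, and t = x - r₁ n₂ - n₂.  With
-- S = (x - n₂) I - L₂, the matrix x I - L of the product is
--
--   ( t I + A₁ ⊗ J   I ⊗ J )
--   (    I ⊗ J       I ⊗ S ).
--
-- Since J S⁻¹ J = χ J, the Schur complement of the lower right block is
-- t I + (A₁ - χ I) ⊗ J.  As J = 1 1ᵀ, Sylvester's determinant identity turns its
-- determinant into t^(n₁ (n₂ - 1)) times that of
-- t I + n₂ (A₁ - χ I) = (x - n₂ - n₂ χ) I - n₂ L₁, which the eigenvalues of L₁ give.

open import Defs
open import Algebra.Apartness.Bundles using (HeytingField; HeytingCommutativeRing)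
open import Algebra.Bundles using (AbelianGroup; CommutativeMonoid; CommutativeRing)
open import Algebra.Bundles.Raw using (RawRing)
import Algebra.Consequences.Setoid as Consequences
open import Algebra.Definitions
  using (Congruent₁; Congruent₂; Associative; Commutative; LeftIdentity; Identity; LeftInverse; Inverse;
         _DistributesOverˡ_; _DistributesOverʳ_)
import Algebra.Morphism.Construct.Composition as Composition
open import Algebra.Morphism.Structures using (IsRingHomomorphism)
open import Algebra.Structures using (IsAbelianGroup)
open import Data.Bool.Base using (true; false; if_then_else_)
open import Data.Fin.Base
  using (Fin; zero; suc; toℕ; inject₁; punchIn; splitAt; combine; quotient; remainder; remQuot; _↑ˡ_; _↑ʳ_)
open import Data.Fin.Properties
  using (_≟_; suc-injective; toℕ-↑ˡ; toℕ-inject₁; splitAt-↑ˡ; splitAt-↑ʳ; remQuot-combine)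
open import Data.Nat.Base as ℕ using (ℕ; zero; suc; NonZero; _∸_)
import Data.Nat.Properties as ℕ
open import Data.Product.Base using (Σ-syntax; _,_; proj₁; proj₂; uncurry) renaming (_×_ to _∧_)
open import Data.Sum.Base using (_⊎_; [_,_]′)
open import Data.Vec.Functional using (Vector; head; tail; updateAt)
open import Data.Vec.Functional.Properties using (updateAt-updates; updateAt-minimal)
open import Function.Base using (_∘_)
open import Level using (Level; _⊔_)
open import Relation.Binary.PropositionalEquality as ≡ using (_≡_; _≢_)
open import Relation.Binary.Structures using (IsEquivalence)
open import Relation.Nullary.Decidable using (Dec; yes; no; does)
open import Relation.Nullary.Negation using (contradiction)

-- Two divisions hide in this outline. Sylvester's identity holds over every commutative ring only
-- with powers of t on both sides, and passing from n₂ L₁ to L₁ divides by n₂. So the matrix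
-- identities are proved over an arbitrary commutative ring, with inverses of t and n₂ as hypotheses
-- of the last step, and are then specialised to K(X). There t and det S are images of polynomials
-- with a coefficient 1, and n₂ is a unit by characteristic zero. Equality in K need not be
-- decidable, so explicit coefficients take the place of computed degrees. The determinant is
-- defined by expansion along the first row, so its multiplicativity needs a proof: the expansion is
-- an alternating multilinear form in the rows, and every such form D satisfies D(M W) = det M D(W).
-- The same properties give the adjugate, hence the inverse of S on which the coronal depends. The
-- eigenvalues come as a factorisation in K[X], but it is used at the rational function (x - n₂ - n₂
-- χ) / n₂; evaluation at that element of K(X) carries it there.

private
  variable
    c ℓ c′ ℓ′ ℓ₁ ℓ₂ : Level
    m n p : ℕ

-- Deleting and splitting indices

punchIn-inject₁ : (j k : Fin n) → toℕ j ℕ.≤ toℕ k → punchIn (inject₁ j) k ≡ suc k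
punchIn-inject₁ zero    k       _           = ≡.refl
punchIn-inject₁ (suc j) (suc k) (ℕ.s≤s j≤k) = ≡.cong suc (punchIn-inject₁ j k j≤k)

punchIn-suc : (j k : Fin n) → toℕ j ℕ.≤ toℕ k → punchIn (suc k) j ≡ inject₁ j
punchIn-suc zero    k       _           = ≡.refl
punchIn-suc (suc j) (suc k) (ℕ.s≤s j≤k) = ≡.cong suc (punchIn-suc j k j≤k)

-- Both sides skip exactly the indices `inject₁ j` and `suc k`: two columns deleted in either order
-- leave the same minor.
punchIn-swap : (j k : Fin (suc n)) (l : Fin n) → toℕ j ℕ.≤ toℕ k →
  punchIn (inject₁ j) (punchIn k l) ≡ punchIn (suc k) (punchIn j l)
punchIn-swap zero    k       l       _           = ≡.refl
punchIn-swap (suc j) (suc k) zero    _           = ≡.refl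
punchIn-swap (suc j) (suc k) (suc l) (ℕ.s≤s j≤k) = ≡.cong suc (punchIn-swap j k l j≤k)

punchIn-↑ˡ : ∀ n (j : Fin (suc m)) (k : Fin m) → punchIn (j ↑ˡ n) (k ↑ˡ n) ≡ punchIn j k ↑ˡ n
punchIn-↑ˡ n zero    k       = ≡.refl
punchIn-↑ˡ n (suc j) zero    = ≡.refl
punchIn-↑ˡ n (suc j) (suc k) = ≡.cong suc (punchIn-↑ˡ n j k)

punchIn-↑ʳ : ∀ (j : Fin (suc m)) (k : Fin n) → punchIn (j ↑ˡ n) (m ↑ʳ k) ≡ suc m ↑ʳ k
punchIn-↑ʳ         zero    k = ≡.refl
punchIn-↑ʳ {suc m} (suc j) k = ≡.cong suc (punchIn-↑ʳ j k)

↑-elim : ∀ m {n a} (P : Fin (m ℕ.+ n) → Set a) → (∀ i → P (i ↑ˡ n)) → (∀ j → P (m ↑ʳ j)) → ∀ u → P u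
↑-elim zero    P l r u       = r u
↑-elim (suc m) P l r zero    = l zero
↑-elim (suc m) P l r (suc u) = ↑-elim m (P ∘ suc) (l ∘ suc) r u

-- Since `combine (suc i) p` reduces to `n ↑ʳ combine i p`, induction on the number of blocks
-- suffices. Block matrices can then be compared at indices of the form `combine i p` only.
combine-elim : ∀ {m n a} (P : Fin (m ℕ.* n) → Set a) → (∀ i p → P (combine {m} i p)) → ∀ u → P u
combine-elim {suc m} {n} P f = ↑-elim n P (f zero) (combine-elim {m} (P ∘ (n ↑ʳ_)) (f ∘ suc))

-- Finite sums over a commutative ring

module Determinants (R : CommutativeRing c ℓ) where
  open CommutativeRing R hiding (_-_; zero)
  open import Data.Vec.Functional using (_∷_)
  open Matrices rawRing
    using (_×_; _^_; sum; product; _-_; nat; Matrix; _≈ᴹ_; _-ᴹ_; _*ᴹ_; diagonal; scalar; det; f;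
           adjacency; laplacian; Invertibleᴹ)
  open import Algebra.Properties.Semiring.Sum semiring
    using (sum-cong-≋; sum-replicate; sum-replicate-zero; ∑-distrib-+; ∑-comm; *-distribˡ-sum; *-distribʳ-sum)
  open import Algebra.Properties.Ring ring
    using (-1*x≈-x; -‿distribˡ-*; -‿distribʳ-*; -‿involutive; -‿+-comm; -0#≈0#; x[y-z]≈xy-xz)
  open import Algebra.Properties.Semiring.Mult semiring using (×-congʳ; ×-assoc-*; ×-homo-+; ×1-homo-*)
  open import Algebra.Properties.CommutativeSemigroup *-commutativeSemigroup
    using (x∙yz≈y∙xz; x∙yz≈yx∙z) renaming (interchange to *-interchange)
  open import Algebra.Properties.CommutativeSemigroup +-commutativeSemigroup
    using () renaming (x∙yz≈y∙xz to x+[y+z]≈y+[x+z])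
  open import Algebra.Definitions.RawMonoid ℕ.+-0-rawMonoid using () renaming (sum to sumℕ)
  open import Algebra.Properties.Semiring.Exp semiring using (^-homo-*)
  open import Algebra.Solver.CommutativeMonoid +-commutativeMonoid using (solve; _⊕_; _⊜_)
  open import Relation.Binary.Reasoning.Setoid setoid

  sum-cong : {u v : Vector Carrier n} → (∀ i → u i ≈ v i) → sum u ≈ sum v
  sum-cong = sum-cong-≋

  product-cong : {u v : Vector Carrier n} → (∀ i → u i ≈ v i) → product u ≈ product v
  product-cong {zero}  u≈v = refl
  product-cong {suc n} u≈v = *-cong (u≈v zero) (product-cong (u≈v ∘ suc))

  sum≈0 : {v : Vector Carrier n} → (∀ i → v i ≈ 0#) → sum v ≈ 0#
  sum≈0 {n} v≈0 = trans (sum-cong v≈0) (sum-replicate-zero n)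

  sum-linear : ∀ c (u v : Vector Carrier n) → sum (λ i → c * u i + v i) ≈ c * sum u + sum v
  sum-linear c u v = trans (∑-distrib-+ _ v) (+-congʳ (sym (*-distribˡ-sum c u)))

  sum-↑ : ∀ m (g : Fin (m ℕ.+ n) → Carrier) →
    sum g ≈ sum (λ i → g (i ↑ˡ n)) + sum (λ j → g (m ↑ʳ j))
  sum-↑ zero    g = sym (+-identityˡ _)
  sum-↑ (suc m) g = trans (+-congˡ (sum-↑ m (g ∘ suc))) (sym (+-assoc _ _ _))

  sum-combine : ∀ m n (g : Fin (m ℕ.* n) → Carrier) →
    sum g ≈ sum (λ (i : Fin m) → sum (λ (j : Fin n) → g (combine i j)))
  sum-combine zero    n g = refl
  sum-combine (suc m) n g = trans (sum-↑ n g) (+-congˡ (sum-combine m n (g ∘ (n ↑ʳ_))))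

  x+y≈0 : ∀ {x y} → x + y ≈ 0# → y ≈ 0# → x ≈ 0#
  x+y≈0 x+y y≈0 = trans (trans (sym (+-identityʳ _)) (+-congˡ (sym y≈0))) x+y

  x*0≈0 : ∀ x {y} → y ≈ 0# → x * y ≈ 0#
  x*0≈0 x y≈0 = trans (*-congˡ y≈0) (zeroʳ x)

  0*x≈0 : ∀ {x} y → x ≈ 0# → x * y ≈ 0#
  0*x≈0 y x≈0 = trans (*-congʳ x≈0) (zeroˡ y)

  -- Alternating multilinear forms in the rows of a matrix

  Mat : ℕ → ℕ → Set _
  Mat m n = Fin m → Fin n → Carrier

  minor : Fin (suc n) → Matrix (suc n) → Matrix n
  minor j M i k = M (suc i) (punchIn j k)

  -- The number `n` of rows and their length `p` are independent, so that fixing the first row gives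
  -- a form of the same kind in the remaining ones. One equation covers additivity and homogeneity.
  -- Only neighbouring rows are compared, which is what the Laplace expansion yields by induction;
  -- `repeated` extends this to all pairs.
  record IsAlternating (D : Mat n p → Carrier) : Set (c ⊔ ℓ) where
    field
      cong        : ∀ {M N} → (∀ i j → M i j ≈ N i j) → D M ≈ D N
      linear      : ∀ i {x M N P} → (∀ j → M i j ≈ x * N i j + P i j) →
                    (∀ k → k ≢ i → ∀ j → (M k j ≈ N k j) ∧ (M k j ≈ P k j)) →
                    D M ≈ x * D N + D P
      alternating : ∀ {i j} → toℕ j ≡ suc (toℕ i) → ∀ {M} → (∀ k → M i k ≈ M j k) → D M ≈ 0#

  module Alternating {D : Mat n p → Carrier} (alt : IsAlternating D) where
    open IsAlternating alt

    zero-row : ∀ i {M} → (∀ j → M i j ≈ 0#) → D M ≈ 0#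
    zero-row i {M} Mi≈0 = begin
      -- A zero row equals `- 1#` times itself plus itself.
      D M               ≈⟨ linear i {x = - 1#} {M} {M} {M} (λ j → lemma (Mi≈0 j)) (λ _ _ _ → refl , refl) ⟩
      - 1# * D M + D M  ≈⟨ +-congʳ (-1*x≈-x _) ⟩
      - D M + D M       ≈⟨ -‿inverseˡ _ ⟩
      0#                ∎
      where
      lemma : ∀ {x} → x ≈ 0# → x ≈ - 1# * x + x
      lemma {x} x≈0 = trans x≈0 (sym (trans (+-congʳ (-1*x≈-x x)) (-‿inverseˡ x)))

  module _ {D : Mat (suc n) p → Carrier} (alt : IsAlternating D) where
    open IsAlternating alt

    head-∷-tail : ∀ M → D M ≈ D (head M ∷ tail M)
    head-∷-tail M = cong λ { zero j → refl ; (suc i) j → refl }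

    ∷-isAlternating : ∀ w → IsAlternating (λ M → D (w ∷ M))
    ∷-isAlternating w = record
      { cong        = λ M≈N → cong λ { zero j → refl ; (suc i) → M≈N i }
      ; linear      = λ i eq eqs → linear (suc i) eq
          λ { zero _ j → refl , refl ; (suc k) k≢i → eqs k (k≢i ∘ ≡.cong suc) }
      ; alternating = λ j≡1+i eq → alternating (≡.cong suc j≡1+i) eq
      }

    linear-∷ : ∀ x u v M → D ((λ j → x * u j + v j) ∷ M) ≈ x * D (u ∷ M) + D (v ∷ M)
    linear-∷ x u v M = linear zero (λ _ → refl)
      λ { zero 0≢0 → contradiction ≡.refl 0≢0 ; (suc k) _ j → refl , refl }

    cong-∷ : ∀ {u v} M → (∀ j → u j ≈ v j) → D (u ∷ M) ≈ D (v ∷ M)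
    cong-∷ M u≈v = cong λ { zero → u≈v ; (suc i) j → refl }

    +-∷ : ∀ u v M → D ((λ j → u j + v j) ∷ M) ≈ D (u ∷ M) + D (v ∷ M)
    +-∷ u v M = begin
      D ((λ j → u j + v j) ∷ M)       ≈⟨ cong-∷ M (λ j → +-congʳ (sym (*-identityˡ (u j)))) ⟩
      D ((λ j → 1# * u j + v j) ∷ M)  ≈⟨ linear-∷ 1# u v M ⟩
      1# * D (u ∷ M) + D (v ∷ M)      ≈⟨ +-congʳ (*-identityˡ _) ⟩
      D (u ∷ M) + D (v ∷ M)           ∎

    sum-∷ : ∀ {q} (x : Vector Carrier q) (W : Mat q p) M →
      D ((λ l → sum λ j → x j * W j l) ∷ M) ≈ sum λ j → x j * D (W j ∷ M)
    sum-∷ {zero}  x W M = Alternating.zero-row alt zero λ _ → refl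
    sum-∷ {suc q} x W M = trans (linear-∷ _ _ _ M) (+-congˡ (sum-∷ (x ∘ suc) (W ∘ suc) M))

  open IsAlternating

  -- Polarisation: the form vanishes when its first two rows are both u + v, and of the four terms
  -- of the expansion the two with equal rows vanish as well.
  swap : {D : Mat (suc (suc n)) p → Carrier} → IsAlternating D →
    ∀ u v M → D (u ∷ v ∷ M) + D (v ∷ u ∷ M) ≈ 0#
  swap {D = D} alt u v M = begin
    D (u ∷ v ∷ M) + D (v ∷ u ∷ M)
      ≈⟨ +-cong (expand u v) (sym (+-identityˡ _)) ⟩
    (D (u ∷ u ∷ M) + D (u ∷ v ∷ M)) + (0# + D (v ∷ u ∷ M))
      ≈⟨ +-congˡ (trans (+-congʳ (sym (equal v))) (+-comm _ _)) ⟩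
    (D (u ∷ u ∷ M) + D (u ∷ v ∷ M)) + (D (v ∷ u ∷ M) + D (v ∷ v ∷ M))
      ≈⟨ +-cong (+-∷ (∷-isAlternating alt u) u v M) (+-∷ (∷-isAlternating alt v) u v M) ⟨
    D (u ∷ w ∷ M) + D (v ∷ w ∷ M)
      ≈⟨ +-∷ alt u v (w ∷ M) ⟨
    D (w ∷ w ∷ M)
      ≈⟨ equal w ⟩
    0# ∎
    where
    w : Fin _ → Carrier
    w j = u j + v j

    equal : ∀ u → D (u ∷ u ∷ M) ≈ 0#
    equal u = alternating alt {zero} {suc zero} ≡.refl λ _ → refl

    expand : ∀ u v → D (u ∷ v ∷ M) ≈ D (u ∷ u ∷ M) + D (u ∷ v ∷ M)
    expand u v = trans (sym (+-identityˡ _)) (+-congʳ (sym (equal u)))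

  -- The vector `w` is moved down past one row after another until it meets its copy. Each exchange
  -- only changes the sign, so vanishing after it implies vanishing before it.
  head-repeated : {D : Mat (suc n) p → Carrier} → IsAlternating D →
    ∀ w i M → (∀ j → M i j ≈ w j) → D (w ∷ M) ≈ 0#
  head-repeated alt w zero M eq = alternating alt {zero} {suc zero} ≡.refl λ j → sym (eq j)
  head-repeated {D = D} alt w (suc i) M eq = begin
    D (w ∷ M)                ≈⟨ head-∷-tail (∷-isAlternating alt w) M ⟩
    D (w ∷ head M ∷ tail M)  ≈⟨ x+y≈0 (swap alt w (head M) (tail M))
                                  (head-repeated (∷-isAlternating alt (head M)) w i (tail M) eq) ⟩
    0#                       ∎

  repeated : {D : Mat n p → Carrier} → IsAlternating D →
    ∀ {i j} → i ≢ j → ∀ M → (∀ k → M i k ≈ M j k) → D M ≈ 0#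
  repeated alt {zero}  {zero}  i≢j M eq = contradiction ≡.refl i≢j
  repeated alt {zero}  {suc j} i≢j M eq =
    trans (head-∷-tail alt M) (head-repeated alt (head M) j (tail M) λ k → sym (eq k))
  repeated alt {suc i} {zero}  i≢j M eq =
    trans (head-∷-tail alt M) (head-repeated alt (head M) i (tail M) eq)
  repeated alt {suc i} {suc j} i≢j M eq =
    trans (head-∷-tail alt M)
      (repeated (∷-isAlternating alt (head M)) (i≢j ∘ ≡.cong suc) (tail M) eq)

  -- Multiples of `w` are removed one row at a time. The hypothesis that the form vanishes whenever
  -- some row is `w` survives fixing the rows already cleaned. In `det-unique`, `w` is the row that
  -- has been fixed in front.
  absorb : {D : Mat n p → Carrier} → IsAlternating D →
    ∀ (w : Vector Carrier p) → (∀ i M → (∀ j → M i j ≈ w j) → D M ≈ 0#) →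
    ∀ (x : Vector Carrier n) (U : Mat n p) → D (λ i j → x i * w j + U i j) ≈ D U
  absorb {zero}          alt w vanish x U = cong alt λ ()
  absorb {suc n} {D = D} alt w vanish x U = begin
    D V                                                    ≈⟨ head-∷-tail alt V ⟩
    D ((λ j → x zero * w j + U zero j) ∷ tail V)           ≈⟨ linear-∷ alt (x zero) w (U zero) (tail V) ⟩
    x zero * D (w ∷ tail V) + D (U zero ∷ tail V)          ≈⟨ +-congʳ (trans (*-congˡ (vanish zero (w ∷ tail V) λ _ → refl)) (zeroʳ _)) ⟩
    0# + D (U zero ∷ tail V)                               ≈⟨ +-identityˡ _ ⟩
    D (U zero ∷ tail V)                                    ≈⟨ absorb (∷-isAlternating alt (U zero)) w
                                                                (λ i M → vanish (suc i) (U zero ∷ M)) (x ∘ suc) (tail U) ⟩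
    D (U zero ∷ tail U)                                    ≈⟨ head-∷-tail alt U ⟨
    D U                                                    ∎
    where
    V : Mat _ _
    V i j = x i * w j + U i j

  -- Bringing row `j` to the front takes `j` exchanges of neighbours. This is where `det-unique`
  -- gets the signs of the Laplace expansion.
  move : {D : Mat (suc n) p → Carrier} → IsAlternating D →
    ∀ W j → D (W j ∷ W ∘ punchIn j) ≈ (- 1#) ^ toℕ j * D W
  move alt W zero = trans (sym (head-∷-tail alt W)) (sym (*-identityˡ _))
  move {suc n} {D = D} alt W (suc j) = begin
    D (W (suc j) ∷ W ∘ punchIn (suc j))
      ≈⟨ cong alt (λ { zero _ → refl ; (suc zero) _ → refl ; (suc (suc i)) _ → refl }) ⟩
    D (W′ j ∷ head W ∷ W′ ∘ punchIn j)
      ≈⟨ negate (swap alt (W′ j) (head W) (W′ ∘ punchIn j)) ⟩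
    - 1# * D (head W ∷ W′ j ∷ W′ ∘ punchIn j)
      ≈⟨ *-congˡ (move (∷-isAlternating alt (head W)) W′ j) ⟩
    - 1# * ((- 1#) ^ toℕ j * D (head W ∷ W′))
      ≈⟨ *-assoc _ _ _ ⟨
    (- 1#) ^ toℕ (suc j) * D (head W ∷ W′)
      ≈⟨ *-congˡ (head-∷-tail alt W) ⟨
    (- 1#) ^ toℕ (suc j) * D W
      ∎
    where
    W′ : Mat (suc n) _
    W′ = tail W

    negate : ∀ {x y} → x + y ≈ 0# → x ≈ - 1# * y
    negate {x} {y} x+y≈0 = begin
      x                ≈⟨ +-identityʳ x ⟨
      x + 0#           ≈⟨ +-congˡ (-‿inverseʳ y) ⟨
      x + (y + - y)    ≈⟨ +-assoc _ _ _ ⟨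
      x + y + - y      ≈⟨ +-congʳ x+y≈0 ⟩
      0# + - y         ≈⟨ +-identityˡ _ ⟩
      - y              ≈⟨ -1*x≈-x y ⟨
      - 1# * y         ∎

  -- The first row of M W contributes a multiple of row j of W; the multiples
  -- of that row in the other rows of M W can then be dropped.
  det-unique : {D : Mat n p → Carrier} → IsAlternating D →
    ∀ (M : Matrix n) W → D (λ i l → sum λ k → M i k * W k l) ≈ det M * D W
  det-unique {zero}          alt M W = trans (cong alt λ ()) (sym (*-identityˡ _))
  det-unique {suc n} {D = D} alt M W = begin
    D MW
      ≈⟨ head-∷-tail alt MW ⟩
    D (head MW ∷ tail MW)
      ≈⟨ sum-∷ alt (M zero) W (tail MW) ⟩
    sum (λ j → M zero j * D (W j ∷ tail MW))
      ≈⟨ sum-cong (λ j → *-congˡ {M zero j} (step j)) ⟩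
    sum (λ j → M zero j * (det (minor j M) * ((- 1#) ^ toℕ j * D W)))
      ≈⟨ sum-cong (λ j → reorder (M zero j) (det (minor j M)) ((- 1#) ^ toℕ j)) ⟩
    sum (λ j → (- 1#) ^ toℕ j * (M zero j * det (minor j M)) * D W)
      ≈⟨ *-distribʳ-sum (D W) (λ j → (- 1#) ^ toℕ j * (M zero j * det (minor j M))) ⟨
    det M * D W
      ∎
    where
    MW : Mat (suc n) _
    MW i l = sum λ k → M i k * W k l

    reorder : ∀ x y z → x * (y * (z * D W)) ≈ z * (x * y) * D W
    reorder x y z = begin
      x * (y * (z * D W))  ≈⟨ *-assoc _ _ _ ⟨
      x * y * (z * D W)    ≈⟨ x∙yz≈yx∙z _ _ _ ⟩
      z * (x * y) * D W    ∎

    remove : ∀ {n} j (v : Vector Carrier (suc n)) → sum v ≈ v j + sum (v ∘ punchIn j)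
    remove zero            v = refl
    remove {suc n} (suc j) v = trans (+-congˡ (remove j (v ∘ suc))) (x+[y+z]≈y+[x+z] _ _ _)

    step : ∀ j → D (W j ∷ tail MW) ≈ det (minor j M) * ((- 1#) ^ toℕ j * D W)
    step j = begin
      D (W j ∷ tail MW)
        ≈⟨ cong alt′ (λ i l → remove j (λ k → M (suc i) k * W k l)) ⟩
      D (W j ∷ λ i l → M (suc i) j * W j l + sum λ k → minor j M i k * W (punchIn j k) l)
        ≈⟨ absorb alt′ (W j) (head-repeated alt (W j)) (λ i → M (suc i) j)
             (λ i l → sum λ k → minor j M i k * W (punchIn j k) l) ⟩
      D (W j ∷ λ i l → sum λ k → minor j M i k * W (punchIn j k) l)
        ≈⟨ det-unique alt′ (minor j M) (W ∘ punchIn j) ⟩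
      det (minor j M) * D (W j ∷ W ∘ punchIn j)
        ≈⟨ *-congˡ (move alt W j) ⟩
      det (minor j M) * ((- 1#) ^ toℕ j * D W)
        ∎
      where
      alt′ : IsAlternating (λ N → D (W j ∷ N))
      alt′ = ∷-isAlternating alt (W j)

  -- The Laplace expansion is an alternating form

  det-cong : {M N : Matrix n} → (∀ i j → M i j ≈ N i j) → det M ≈ det N
  det-cong {zero}  M≈N = refl
  det-cong {suc n} M≈N = sum-cong λ j →
    *-congˡ {(- 1#) ^ toℕ j} (*-cong (M≈N zero j) (det-cong λ i k → M≈N (suc i) (punchIn j k)))

  -- Row `i` enters each term of the expansion exactly once: through the entry if it is the first
  -- row, and otherwise through the minor, to which induction applies.
  det-linear : ∀ i {x} {M N P : Matrix n} → (∀ j → M i j ≈ x * N i j + P i j) →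
    (∀ k → k ≢ i → ∀ j → (M k j ≈ N k j) ∧ (M k j ≈ P k j)) →
    det M ≈ x * det N + det P
  det-linear {suc n} i {x} {M} {N} {P} eq eqs = trans (sum-cong (term i eq eqs)) (sum-linear x
      (λ j → (- 1#) ^ toℕ j * (N zero j * det (minor j N))) (λ j → (- 1#) ^ toℕ j * (P zero j * det (minor j P))))
    where
    split : ∀ {u v w s} → u ≈ x * v + w → s * u ≈ x * (s * v) + s * w
    split eq = trans (*-congˡ eq) (trans (distribˡ _ _ _) (+-congʳ (x∙yz≈y∙xz _ _ _)))

    term : ∀ i → (∀ j → M i j ≈ x * N i j + P i j) →
      (∀ k → k ≢ i → ∀ j → (M k j ≈ N k j) ∧ (M k j ≈ P k j)) →
      ∀ j → (- 1#) ^ toℕ j * (M zero j * det (minor j M)) ≈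
        x * ((- 1#) ^ toℕ j * (N zero j * det (minor j N))) + (- 1#) ^ toℕ j * (P zero j * det (minor j P))
    term zero eq eqs j = split (begin
      M zero j * det (minor j M)
        ≈⟨ *-congʳ (eq j) ⟩
      (x * N zero j + P zero j) * det (minor j M)
        ≈⟨ distribʳ _ _ _ ⟩
      x * N zero j * det (minor j M) + P zero j * det (minor j M)
        ≈⟨ +-cong (trans (*-assoc _ _ _) (*-congˡ (*-congˡ (det-cong λ i k → proj₁ (eqs (suc i) (λ ()) (punchIn j k))))))
                  (*-congˡ (det-cong λ i k → proj₂ (eqs (suc i) (λ ()) (punchIn j k)))) ⟩
      x * (N zero j * det (minor j N)) + P zero j * det (minor j P)
        ∎)
    term (suc i) eq eqs j = split (begin
      M zero j * det (minor j M)
        ≈⟨ *-congˡ (det-linear i (λ k → eq (punchIn j k)) λ k k≢i l → eqs (suc k) (k≢i ∘ suc-injective) (punchIn j l)) ⟩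
      M zero j * (x * det (minor j N) + det (minor j P))
        ≈⟨ distribˡ _ _ _ ⟩
      M zero j * (x * det (minor j N)) + M zero j * det (minor j P)
        ≈⟨ +-cong (trans (x∙yz≈y∙xz _ _ _) (*-congˡ (*-congʳ (proj₁ (eqs zero (λ ()) j)))))
                  (*-congʳ (proj₂ (eqs zero (λ ()) j))) ⟩
      x * (N zero j * det (minor j N)) + P zero j * det (minor j P)
        ∎)

  -- The index pairs split into those (`inject₁ j`, `k`) with `j` at most `k` and their mirror
  -- images (`suc k`, `j`). Each step of the induction removes the first row and the rest of the
  -- first column of `G`, which cancel against each other.
  sum-pairs≈0 : (G : Fin (suc n) → Fin n → Carrier) →
    (∀ j k → toℕ j ℕ.≤ toℕ k → G (inject₁ j) k + G (suc k) j ≈ 0#) →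
    sum (λ j → sum (G j)) ≈ 0#
  sum-pairs≈0 {zero}  G G≈0 = +-identityʳ 0#
  sum-pairs≈0 {suc n} G G≈0 = begin
    sum (G zero) + sum (λ j → G (suc j) zero + sum (λ k → G (suc j) (suc k)))
      ≈⟨ +-congˡ (∑-distrib-+ (λ j → G (suc j) zero) (λ j → sum (λ k → G (suc j) (suc k)))) ⟩
    sum (G zero) + (sum (λ j → G (suc j) zero) + sum (λ j → sum (λ k → G (suc j) (suc k))))
      ≈⟨ +-congˡ (trans (+-congˡ rest≈0) (+-identityʳ _)) ⟩
    sum (G zero) + sum (λ j → G (suc j) zero)
      ≈⟨ ∑-distrib-+ (G zero) (λ j → G (suc j) zero) ⟨
    sum (λ k → G zero k + G (suc k) zero)
      ≈⟨ sum≈0 (λ k → G≈0 zero k ℕ.z≤n) ⟩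
    0#
      ∎
    where
    rest≈0 : sum (λ j → sum (λ k → G (suc j) (suc k))) ≈ 0#
    rest≈0 = sum-pairs≈0 (λ j k → G (suc j) (suc k)) λ j k j≤k → G≈0 (suc j) (suc k) (ℕ.s≤s j≤k)

  -- If the equal rows are the first two, a double expansion meets every pair of columns in both
  -- orders, with the same complementary minor and opposite signs. Otherwise every minor of the
  -- first row still contains both rows.
  det-alternating : ∀ {i j : Fin n} → toℕ j ≡ suc (toℕ i) → {M : Matrix n} →
    (∀ k → M i k ≈ M j k) → det M ≈ 0#
  det-alternating {suc (suc n)} {zero} {suc zero} _ {M} eq = begin
    det M                     ≈⟨ sum-cong expand ⟩
    sum (λ j → sum (G j))     ≈⟨ sum-pairs≈0 G cancel ⟩
    0#                        ∎
    where
    s : Fin m → Carrier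
    s j = (- 1#) ^ toℕ j

    d : Fin (suc (suc n)) → Fin (suc n) → Carrier
    d j k = det (minor k (minor j M))

    G : Fin (suc (suc n)) → Fin (suc n) → Carrier
    G j k = s j * (M zero j * (s k * (M (suc zero) (punchIn j k) * d j k)))

    expand : ∀ j → s j * (M zero j * det (minor j M)) ≈ sum (G j)
    expand j = trans (*-congˡ (*-distribˡ-sum (M zero j) λ k → s k * (M (suc zero) (punchIn j k) * d j k)))
                     (*-distribˡ-sum (s j) λ k → M zero j * (s k * (M (suc zero) (punchIn j k) * d j k)))

    reorder : ∀ s u t v d → s * (u * (t * (v * d))) ≈ t * (v * (s * (u * d)))
    reorder s u t v d = begin
      s * (u * (t * (v * d)))  ≈⟨ *-congˡ (x∙yz≈y∙xz u t _) ⟩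
      s * (t * (u * (v * d)))  ≈⟨ x∙yz≈y∙xz s t _ ⟩
      t * (s * (u * (v * d)))  ≈⟨ *-congˡ (*-congˡ (x∙yz≈y∙xz u v d)) ⟩
      t * (s * (v * (u * d)))  ≈⟨ *-congˡ (x∙yz≈y∙xz s v _) ⟩
      t * (v * (s * (u * d)))  ∎

    cancel : ∀ j k → toℕ j ℕ.≤ toℕ k → G (inject₁ j) k + G (suc k) j ≈ 0#
    cancel j k j≤k = begin
      G (inject₁ j) k + G (suc k) j
        ≈⟨ +-cong first second ⟩
      s k * y + - (s k * y)
        ≈⟨ -‿inverseʳ _ ⟩
      0# ∎
      where
      y : Carrier
      y = M zero (suc k) * (s j * (M zero (inject₁ j) * d (inject₁ j) k))

      first : G (inject₁ j) k ≈ s k * y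
      first = begin
        G (inject₁ j) k
          ≡⟨ ≡.cong₂ (λ v w → (- 1#) ^ v * (M zero (inject₁ j) * (s k * (M (suc zero) w * d (inject₁ j) k))))
               (toℕ-inject₁ j) (punchIn-inject₁ j k j≤k) ⟩
        s j * (M zero (inject₁ j) * (s k * (M (suc zero) (suc k) * d (inject₁ j) k)))
          ≈⟨ *-congˡ (*-congˡ (*-congˡ (*-congʳ (eq (suc k))))) ⟨
        s j * (M zero (inject₁ j) * (s k * (M zero (suc k) * d (inject₁ j) k)))
          ≈⟨ reorder _ _ _ _ _ ⟩
        s k * y
          ∎

      -- Column `suc k` of `M` becomes column `k` once a smaller column is deleted, while the
      -- smaller column keeps its number whichever goes first. So the two orders differ by exactly
      -- one factor `- 1#`.
      second : G (suc k) j ≈ - (s k * y)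
      second = begin
        G (suc k) j
          ≡⟨ ≡.cong (λ w → s (suc k) * (M zero (suc k) * (s j * (M (suc zero) w * d (suc k) j)))) (punchIn-suc j k j≤k) ⟩
        - 1# * s k * (M zero (suc k) * (s j * (M (suc zero) (inject₁ j) * d (suc k) j)))
          ≈⟨ *-congˡ (*-congˡ (*-congˡ (*-cong (sym (eq (inject₁ j)))
               (det-cong λ i l → reflexive (≡.cong (M (suc (suc i))) (≡.sym (punchIn-swap j k l j≤k))))))) ⟩
        - 1# * s k * y
          ≈⟨ *-assoc _ _ _ ⟩
        - 1# * (s k * y)
          ≈⟨ -1*x≈-x _ ⟩
        - (s k * y)
          ∎
  det-alternating {suc n} {suc i} {suc j} j≡1+i {M} eq = sum≈0 λ k →
    x*0≈0 ((- 1#) ^ toℕ k) (x*0≈0 (M zero k) (det-alternating (≡.cong ℕ.pred j≡1+i) λ l → eq (punchIn k l)))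

  det-isAlternating : IsAlternating (det {n})
  det-isAlternating = record { cong = det-cong ; linear = det-linear ; alternating = det-alternating }

  det-* : (M N : Matrix n) → det (M *ᴹ N) ≈ det M * det N
  det-* = det-unique det-isAlternating

  -- Row replacement and the adjugate

  module _ (M : Matrix n) where
    _[_]≔ʳ_ : Fin n → Vector Carrier n → Matrix n
    _[_]≔ʳ_ j v = updateAt M j (λ _ → v)

    []≔-same : ∀ j v k → _[_]≔ʳ_ j v j k ≈ v k
    []≔-same j v k = reflexive (≡.cong (λ r → r k) (updateAt-updates j M))

    []≔-other : ∀ i j v k → i ≢ j → _[_]≔ʳ_ j v i k ≈ M i k
    []≔-other i j v k i≢j = reflexive (≡.cong (λ r → r k) (updateAt-minimal i j M i≢j))

    det-sum : ∀ j (x : Vector Carrier p) (W : Mat p n) →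
      det (_[_]≔ʳ_ j (λ l → sum λ k → x k * W k l)) ≈ sum λ k → x k * det (_[_]≔ʳ_ j (W k))
    det-sum {zero}  j x W = Alternating.zero-row det-isAlternating j ([]≔-same j _)
    det-sum {suc p} j x W = trans
      (det-linear j
        (λ l → trans ([]≔-same j _ l) (sym (+-cong (*-congˡ ([]≔-same j _ l)) ([]≔-same j _ l))))
        (λ k k≢j l → trans ([]≔-other k j _ l k≢j) (sym ([]≔-other k j _ l k≢j))
                   , trans ([]≔-other k j _ l k≢j) (sym ([]≔-other k j _ l k≢j))))
      (+-congˡ (det-sum j (x ∘ suc) (W ∘ suc)))

    -- The cofactor of row `j` and column `k`, written as the determinant of `M` with a unit vector
    -- in row `j`. This form needs neither signs nor minors and leaves the product with `M` to
    -- linearity in that row.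
    adjugate : Matrix n
    adjugate k j = det (_[_]≔ʳ_ j (scalar 1# k))

  scalar-≡ : ∀ {x} (i : Fin n) → scalar x i i ≈ x
  scalar-≡ i with i ≟ i
  ... | yes _   = refl
  ... | no  i≢i = contradiction ≡.refl i≢i

  scalar-≢ : ∀ {x} {i j : Fin n} → i ≢ j → scalar x i j ≈ 0#
  scalar-≢ {i = i} {j} i≢j with i ≟ j
  ... | yes i≡j = contradiction i≡j i≢j
  ... | no  _   = refl

  sum-scalarˡ : ∀ x i (v : Vector Carrier n) → sum (λ k → scalar x i k * v k) ≈ x * v i
  sum-scalarˡ x zero    v = trans (+-congˡ (sum≈0 λ k → zeroˡ (v (suc k)))) (+-identityʳ _)
  sum-scalarˡ x (suc i) v = trans (+-cong (zeroˡ _) (sum-scalarˡ x i (v ∘ suc))) (+-identityˡ _)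

  sum-scalarʳ : ∀ x j (v : Vector Carrier n) → sum (λ k → v k * scalar x k j) ≈ v j * x
  sum-scalarʳ x zero    v = trans (+-congˡ (sum≈0 λ k → zeroʳ (v (suc k)))) (+-identityʳ _)
  sum-scalarʳ x (suc j) v = trans (+-cong (zeroʳ _) (sum-scalarʳ x j (v ∘ suc))) (+-identityˡ _)

  -- By linearity the entry is the determinant of `M` with row `j` overwritten by row `i`: nothing
  -- changes if the two indices agree, and a row is repeated otherwise.
  *-adjugate : (M : Matrix n) → (M *ᴹ adjugate M) ≈ᴹ scalar (det M)
  *-adjugate M i j = begin
    sum (λ k → M i k * adjugate M k j)
      ≈⟨ det-sum M j (M i) (scalar 1#) ⟨
    det (_[_]≔ʳ_ M j (λ l → sum λ k → M i k * scalar 1# k l))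
      ≈⟨ case (i ≟ j) ⟩
    scalar (det M) i j
      ∎
    where
    r : Vector Carrier _
    r l = sum λ k → M i k * scalar 1# k l

    r≈ : ∀ l → r l ≈ M i l
    r≈ l = trans (sum-scalarʳ 1# l (M i)) (*-identityʳ _)

    case : Dec (i ≡ j) → det (_[_]≔ʳ_ M j r) ≈ scalar (det M) i j
    case (yes ≡.refl) = trans (det-cong same) (sym (scalar-≡ i))
      where
      same : ∀ k l → _[_]≔ʳ_ M i r k l ≈ M k l
      same k l with k ≟ i
      ... | yes ≡.refl = trans ([]≔-same M i r l) (r≈ l)
      ... | no  k≢i    = []≔-other M k i r l k≢i
    case (no i≢j) = trans
      (repeated det-isAlternating i≢j (_[_]≔ʳ_ M j r)
        λ k → trans ([]≔-other M i j r k i≢j) (trans (sym (r≈ k)) (sym ([]≔-same M j r k))))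
      (sym (scalar-≢ i≢j))

  -- Diagonal, triangular and block matrices

  diagonal-↑ˡ : ∀ n (d : Vector Carrier (m ℕ.+ n)) i j →
    diagonal d (i ↑ˡ n) (j ↑ˡ n) ≡ diagonal (λ k → d (k ↑ˡ n)) i j
  diagonal-↑ˡ n d zero    zero    = ≡.refl
  diagonal-↑ˡ n d zero    (suc j) = ≡.refl
  diagonal-↑ˡ n d (suc i) zero    = ≡.refl
  diagonal-↑ˡ n d (suc i) (suc j) = diagonal-↑ˡ n (d ∘ suc) i j

  diagonal-↑ʳ : ∀ m (d : Vector Carrier (m ℕ.+ n)) i j →
    diagonal d (m ↑ʳ i) (m ↑ʳ j) ≡ diagonal (λ k → d (m ↑ʳ k)) i j
  diagonal-↑ʳ zero    d i j = ≡.refl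
  diagonal-↑ʳ (suc m) d i j = diagonal-↑ʳ m (d ∘ suc) i j

  diagonal-↑ˡ↑ʳ : (d : Vector Carrier (m ℕ.+ n)) → ∀ i j → diagonal d (i ↑ˡ n) (m ↑ʳ j) ≡ 0#
  diagonal-↑ˡ↑ʳ d zero    j = ≡.refl
  diagonal-↑ˡ↑ʳ d (suc i) j = diagonal-↑ˡ↑ʳ (d ∘ suc) i j

  diagonal-↑ʳ↑ˡ : (d : Vector Carrier (m ℕ.+ n)) → ∀ i j → diagonal d (m ↑ʳ i) (j ↑ˡ n) ≡ 0#
  diagonal-↑ʳ↑ˡ d i zero    = ≡.refl
  diagonal-↑ʳ↑ˡ d i (suc j) = diagonal-↑ʳ↑ˡ (d ∘ suc) i j

  -- Here and below, `scalar (S p q) i j` is how an entry of the Kronecker product I ⊗ S is written;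
  -- in this lemma the blocks may also vary with `i`.
  diagonal-combine : (d : Vector Carrier (m ℕ.* n)) (i j : Fin m) (p q : Fin n) →
    diagonal d (combine i p) (combine j q) ≡ scalar (diagonal (λ p → d (combine i p)) p q) i j
  diagonal-combine {suc m} {n} d zero    zero    p q = diagonal-↑ˡ (m ℕ.* n) d p q
  diagonal-combine {suc m} {n} d zero    (suc j) p q = diagonal-↑ˡ↑ʳ d p (combine j q)
  diagonal-combine {suc m} {n} d (suc i) zero    p q = diagonal-↑ʳ↑ˡ d (combine i p) q
  diagonal-combine {suc m} {n} d (suc i) (suc j) p q =
    ≡.trans (diagonal-↑ʳ n d (combine i p) (combine j q)) (diagonal-combine (d ∘ (n ↑ʳ_)) i j p q)

  diagonal-cong : {d e : Vector Carrier n} → (∀ i → d i ≈ e i) → ∀ i j → diagonal d i j ≈ diagonal e i j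
  diagonal-cong d≈e i j with does (i ≟ j)
  ... | true  = d≈e i
  ... | false = refl

  f-cong : ∀ (M : Matrix n) {s t} → s ≈ t → f M s ≈ f M t
  f-cong {n} M s≈t = det-cong {n} λ i j → +-congʳ { - M i j} (diagonal-cong (λ _ → s≈t) i j)

  scalar-1* : ∀ x (i j : Fin n) → scalar x i j ≈ scalar 1# i j * x
  scalar-1* x i j with does (i ≟ j)
  ... | true  = sym (*-identityˡ x)
  ... | false = sym (zeroˡ x)

  1^ : ∀ n → 1# ^ n ≈ 1#
  1^ zero    = refl
  1^ (suc n) = trans (*-identityˡ _) (1^ n)

  det-first-row : (M : Matrix (suc n)) → (∀ j → M zero (suc j) ≈ 0#) →
    det M ≈ M zero zero * det (minor zero M)
  det-first-row M M≈0 = begin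
    1# * (M zero zero * det (minor zero M)) + _
      ≈⟨ +-cong (*-identityˡ _) (sum≈0 λ j → x*0≈0 ((- 1#) ^ toℕ (suc j)) (0*x≈0 (det (minor (suc j) M)) (M≈0 j))) ⟩
    M zero zero * det (minor zero M) + 0#
      ≈⟨ +-identityʳ _ ⟩
    M zero zero * det (minor zero M)
      ∎

  det-first-column≈0 : (M : Matrix (suc n)) → (∀ i → M i zero ≈ 0#) → det M ≈ 0#
  det-first-column≈0 M M≈0 = sum≈0 λ j → x*0≈0 ((- 1#) ^ toℕ j) (term j M M≈0)
    where
    term : ∀ {n} j (M : Matrix (suc n)) → (∀ i → M i zero ≈ 0#) → M zero j * det (minor j M) ≈ 0#
    term zero            M M≈0 = 0*x≈0 (det (minor zero M)) (M≈0 zero)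
    term {suc n} (suc j) M M≈0 = x*0≈0 (M zero (suc j)) (det-first-column≈0 (minor (suc j) M) (M≈0 ∘ suc))

  -- The definition expands along a row, so the zeros below the corner have to be followed into the
  -- minors: all minors but the first keep the zero column.
  det-first-column : (M : Matrix (suc n)) → (∀ i → M (suc i) zero ≈ 0#) →
    det M ≈ M zero zero * det (minor zero M)
  det-first-column M M≈0 = begin
    1# * (M zero zero * det (minor zero M)) + _
      ≈⟨ +-cong (*-identityˡ _) (sum≈0 λ j → x*0≈0 ((- 1#) ^ toℕ (suc j)) (x*0≈0 (M zero (suc j)) (minor≈0 j M M≈0))) ⟩
    M zero zero * det (minor zero M) + 0#
      ≈⟨ +-identityʳ _ ⟩
    M zero zero * det (minor zero M)
      ∎
    where
    minor≈0 : ∀ {n} j (M : Matrix (suc n)) → (∀ i → M (suc i) zero ≈ 0#) → det (minor (suc j) M) ≈ 0#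
    minor≈0 {suc n} j M M≈0 = det-first-column≈0 (minor (suc j) M) M≈0

  det-scalar : ∀ n x → det (scalar {n} x) ≈ x ^ n
  det-scalar zero    x = refl
  det-scalar (suc n) x = trans (det-first-row (scalar {suc n} x) λ j → refl) (*-congˡ (det-scalar n x))

  det-scale : ∀ n x (M : Matrix n) → det (λ i j → x * M i j) ≈ x ^ n * det M
  det-scale n x M = begin
    det (λ i j → x * M i j)    ≈⟨ det-cong (λ i j → sum-scalarˡ x i (λ k → M k j)) ⟨
    det (scalar x *ᴹ M)        ≈⟨ det-* (scalar x) M ⟩
    det (scalar {n} x) * det M ≈⟨ *-congʳ (det-scalar n x) ⟩
    x ^ n * det M              ∎

  module _ (m : ℕ) {n : ℕ} (M : Matrix (m ℕ.+ n)) where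
    topLeft : Matrix m
    topLeft i j = M (i ↑ˡ n) (j ↑ˡ n)

    topRight : Mat m n
    topRight i j = M (i ↑ˡ n) (m ↑ʳ j)

    bottomLeft : Mat n m
    bottomLeft i j = M (m ↑ʳ i) (j ↑ˡ n)

    bottomRight : Matrix n
    bottomRight i j = M (m ↑ʳ i) (m ↑ʳ j)

  -- Only the columns of the upper left block contribute to the first row, and deleting one of them
  -- leaves a matrix of the same shape with the same lower right block.
  det-lower-block : ∀ m {n} (M : Matrix (m ℕ.+ n)) → (∀ i j → topRight m M i j ≈ 0#) →
    det M ≈ det (topLeft m M) * det (bottomRight m M)
  det-lower-block zero        M M≈0 = sym (*-identityˡ _)
  det-lower-block (suc m) {n} M M≈0 = begin
    det M
      ≈⟨ sum-↑ (suc m) (λ j → (- 1#) ^ toℕ j * (M zero j * det (minor j M))) ⟩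
    sum (λ j → (- 1#) ^ toℕ (j ↑ˡ n) * (M zero (j ↑ˡ n) * det (minor (j ↑ˡ n) M))) + _
      ≈⟨ +-congˡ (sum≈0 λ j → x*0≈0 ((- 1#) ^ toℕ (suc m ↑ʳ j)) (0*x≈0 (det (minor (suc m ↑ʳ j) M)) (M≈0 zero j))) ⟩
    sum (λ j → (- 1#) ^ toℕ (j ↑ˡ n) * (M zero (j ↑ˡ n) * det (minor (j ↑ˡ n) M))) + 0#
      ≈⟨ +-identityʳ _ ⟩
    sum (λ j → (- 1#) ^ toℕ (j ↑ˡ n) * (M zero (j ↑ˡ n) * det (minor (j ↑ˡ n) M)))
      ≈⟨ sum-cong term ⟩
    sum (λ j → (- 1#) ^ toℕ j * (A zero j * det (minor j A)) * det D)
      ≈⟨ *-distribʳ-sum (det D) (λ j → (- 1#) ^ toℕ j * (A zero j * det (minor j A))) ⟨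
    det A * det D
      ∎
    where
    A : Matrix (suc m)
    A = topLeft (suc m) M

    D : Matrix n
    D = bottomRight (suc m) M

    minor-M : ∀ j → det (minor (j ↑ˡ n) M) ≈ det (minor j A) * det D
    minor-M j = begin
      det (minor (j ↑ˡ n) M)
        ≈⟨ det-lower-block m (minor (j ↑ˡ n) M) (λ i k →
             trans (reflexive (≡.cong (M (suc i ↑ˡ n)) (punchIn-↑ʳ j k))) (M≈0 (suc i) k)) ⟩
      det (topLeft m (minor (j ↑ˡ n) M)) * det (bottomRight m (minor (j ↑ˡ n) M))
        ≈⟨ *-cong (det-cong λ i k → reflexive (≡.cong (M (suc i ↑ˡ n)) (punchIn-↑ˡ n j k)))
                  (det-cong λ i k → reflexive (≡.cong (M (suc m ↑ʳ i)) (punchIn-↑ʳ j k))) ⟩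
      det (minor j A) * det D
        ∎

    term : ∀ j → (- 1#) ^ toℕ (j ↑ˡ n) * (M zero (j ↑ˡ n) * det (minor (j ↑ˡ n) M))
      ≈ (- 1#) ^ toℕ j * (A zero j * det (minor j A)) * det D
    term j = begin
      (- 1#) ^ toℕ (j ↑ˡ n) * (A zero j * det (minor (j ↑ˡ n) M))
        ≈⟨ *-cong (reflexive (≡.cong ((- 1#) ^_) (toℕ-↑ˡ j n))) (*-congˡ (minor-M j)) ⟩
      (- 1#) ^ toℕ j * (A zero j * (det (minor j A) * det D))
        ≈⟨ *-congˡ (*-assoc _ _ _) ⟨
      (- 1#) ^ toℕ j * (A zero j * det (minor j A) * det D)
        ≈⟨ *-assoc _ _ _ ⟨
      (- 1#) ^ toℕ j * (A zero j * det (minor j A)) * det D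
        ∎

  -- The scalar block leaves only the corner entry in the first column; splitting that column off
  -- preserves the shape.
  det-upper-block : ∀ m {n} x (M : Matrix (m ℕ.+ n)) → topLeft m M ≈ᴹ scalar x →
    (∀ i j → bottomLeft m M i j ≈ 0#) → det M ≈ x ^ m * det (bottomRight m M)
  det-upper-block zero    x M M≈x M≈0 = sym (*-identityˡ _)
  det-upper-block (suc m) x M M≈x M≈0 = begin
    det M
      ≈⟨ det-first-column M (↑-elim m (λ u → M (suc u) zero ≈ 0#) (λ i → M≈x (suc i) zero) (λ j → M≈0 j zero)) ⟩
    M zero zero * det (minor zero M)
      ≈⟨ *-cong (M≈x zero zero)
                (det-upper-block m x (minor zero M) (λ i j → M≈x (suc i) (suc j)) (λ i j → M≈0 i (suc j))) ⟩
    x * (x ^ m * det (bottomRight (suc m) M))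
      ≈⟨ *-assoc _ _ _ ⟨
    x ^ suc m * det (bottomRight (suc m) M)
      ∎

  det-⊗ : ∀ m {n} (S : Matrix n) (M : Matrix (m ℕ.* n)) →
    (∀ (i j : Fin m) p q → M (combine i p) (combine j q) ≈ scalar (S p q) i j) → det M ≈ det S ^ m
  det-⊗ zero        S M M≈S = refl
  det-⊗ (suc m) {n} S M M≈S = trans
    (det-lower-block n M λ p → combine-elim {m} (λ v → M (p ↑ˡ _) (n ↑ʳ v) ≈ 0#) λ j q → M≈S zero (suc j) p q)
    (*-cong (det-cong (M≈S zero zero))
            (det-⊗ m S (bottomRight n M) λ i j → M≈S (suc i) (suc j)))

  module _ (A : Mat m m) (B : Mat m n) (C : Mat n m) (D : Mat n n) where
    block : Matrix (m ℕ.+ n)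
    block u v = [ (λ i → [ A i , B i ]′ (splitAt m v)) , (λ i → [ C i , D i ]′ (splitAt m v)) ]′ (splitAt m u)

    block-topLeft : ∀ i j → topLeft m block i j ≡ A i j
    block-topLeft i j rewrite splitAt-↑ˡ m i n | splitAt-↑ˡ m j n = ≡.refl

    block-topRight : ∀ i j → topRight m block i j ≡ B i j
    block-topRight i j rewrite splitAt-↑ˡ m i n | splitAt-↑ʳ m n j = ≡.refl

    block-bottomLeft : ∀ i j → bottomLeft m block i j ≡ C i j
    block-bottomLeft i j rewrite splitAt-↑ʳ m n i | splitAt-↑ˡ m j n = ≡.refl

    block-bottomRight : ∀ i j → bottomRight m block i j ≡ D i j
    block-bottomRight i j rewrite splitAt-↑ʳ m n i | splitAt-↑ʳ m n j = ≡.refl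

    block-*-top : ∀ M i v → (block *ᴹ M) (i ↑ˡ n) v ≈
      sum (λ k → A i k * M (k ↑ˡ n) v) + sum (λ k → B i k * M (m ↑ʳ k) v)
    block-*-top M i v = trans (sum-↑ m λ k → block (i ↑ˡ n) k * M k v)
      (+-cong (sum-cong λ k → *-congʳ {M (k ↑ˡ n) v} (reflexive (block-topLeft i k)))
              (sum-cong λ k → *-congʳ {M (m ↑ʳ k) v} (reflexive (block-topRight i k))))

    block-*-bottom : ∀ M i v → (block *ᴹ M) (m ↑ʳ i) v ≈
      sum (λ k → C i k * M (k ↑ˡ n) v) + sum (λ k → D i k * M (m ↑ʳ k) v)
    block-*-bottom M i v = trans (sum-↑ m λ k → block (m ↑ʳ i) k * M k v)
      (+-cong (sum-cong λ k → *-congʳ {M (k ↑ˡ n) v} (reflexive (block-bottomLeft i k)))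
              (sum-cong λ k → *-congʳ {M (m ↑ʳ k) v} (reflexive (block-bottomRight i k))))

  0ᴹ : Mat m n
  0ᴹ i j = 0#

  sum-1ˡ : ∀ (i : Fin n) (v : Vector Carrier n) → sum (λ k → scalar 1# i k * v k) ≈ v i
  sum-1ˡ i v = trans (sum-scalarˡ 1# i v) (*-identityˡ _)

  sum-1ʳ : ∀ (j : Fin n) (v : Vector Carrier n) → sum (λ k → v k * scalar 1# k j) ≈ v j
  sum-1ʳ j v = trans (sum-scalarʳ 1# j v) (*-identityʳ _)

  sum-0ᴹ : ∀ {m} (v : Vector Carrier n) {i : Fin m} → sum (λ k → 0ᴹ i k * v k) ≈ 0#
  sum-0ᴹ v = sum≈0 λ k → zeroˡ (v k)

  -- Schur complements and Sylvester's identity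

  module _ (m : ℕ) {n : ℕ} (M : Matrix (m ℕ.+ n)) (B : Mat m n) where
    -- The block `B` stands for minus the upper right block times the inverse of the lower right
    -- one. Supplying it directly, with the equation that it satisfies, avoids inverting the large
    -- block.
    schur : Matrix m
    schur i j = topLeft m M i j + sum λ k → B i k * bottomLeft m M k j

    -- Left multiplication by the unipotent `E` adds `B` times the lower rows to the upper ones.
    -- This clears the upper right block and keeps the determinant.
    det-schur : (∀ i j → topRight m M i j + sum (λ k → B i k * bottomRight m M k j) ≈ 0#) →
      det M ≈ det schur * det (bottomRight m M)
    det-schur eq = begin
      det M
        ≈⟨ *-identityˡ _ ⟨
      1# * det M
        ≈⟨ *-congʳ det-E ⟨
      det E * det M
        ≈⟨ det-* E M ⟨
      det EM
        ≈⟨ det-lower-block m EM (λ i j → trans (top i (m ↑ʳ j)) (eq i j)) ⟩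
      det (topLeft m EM) * det (bottomRight m EM)
        ≈⟨ *-cong (det-cong λ i j → top i (j ↑ˡ n)) (det-cong λ i j → bottom i (m ↑ʳ j)) ⟩
      det schur * det (bottomRight m M)
        ∎
      where
      E EM : Matrix (m ℕ.+ n)
      E = block (scalar 1#) B 0ᴹ (scalar 1#)
      EM = E *ᴹ M

      top : ∀ i v → EM (i ↑ˡ n) v ≈ M (i ↑ˡ n) v + sum λ k → B i k * M (m ↑ʳ k) v
      top i v = trans (block-*-top (scalar 1#) B 0ᴹ (scalar 1#) M i v)
        (+-congʳ (sum-1ˡ i (λ k → M (k ↑ˡ n) v)))

      bottom : ∀ i v → EM (m ↑ʳ i) v ≈ M (m ↑ʳ i) v
      bottom i v = trans (block-*-bottom (scalar 1#) B 0ᴹ (scalar 1#) M i v)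
        (trans (+-cong (sum-0ᴹ (λ k → M (k ↑ˡ n) v) {i}) (sum-1ˡ i (λ k → M (m ↑ʳ k) v))) (+-identityˡ _))

      det-E : det E ≈ 1#
      det-E = begin
        det E
          ≈⟨ det-upper-block m 1# E (λ i j → reflexive (block-topLeft (scalar 1#) B 0ᴹ (scalar 1#) i j))
                                    (λ i j → reflexive (block-bottomLeft (scalar 1#) B 0ᴹ (scalar 1#) i j)) ⟩
        1# ^ m * det (bottomRight m E)
          ≈⟨ *-cong (1^ m) (det-cong λ i j → reflexive (block-bottomRight (scalar 1#) B 0ᴹ (scalar 1#) i j)) ⟩
        1# * det (scalar {n} 1#)
          ≈⟨ trans (*-identityˡ _) (trans (det-scalar n 1#) (1^ n)) ⟩
        1#
          ∎

  -- Division by `x` is avoided by multiplying Q = (x I, -U; V, I) on the left by E = (I, 0; -V, x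
  -- I), which has determinant x^n. The Schur complement of the identity block of Q is x I + U V,
  -- and E Q is block upper triangular with diagonal blocks x I and x I + V U.
  sylvester : ∀ {m n} x (U : Mat m n) (V : Mat n m) →
    x ^ n * det (λ i j → scalar x i j + sum λ k → U i k * V k j) ≈
    x ^ m * det (λ i j → scalar x i j + sum λ k → V i k * U k j)
  sylvester {m} {n} x U V = begin
    x ^ n * det P
      ≈⟨ *-cong det-E (trans det-Q (det-cong λ i j → +-cong (reflexive (Q-tl i j))
           (sum-cong λ k → *-congˡ {U i k} (reflexive (Q-bl k j))))) ⟨
    det E * det Q
      ≈⟨ det-* E Q ⟨
    det EQ
      ≈⟨ det-upper-block m x EQ EQ-tl EQ-bl ⟩
    x ^ m * det (bottomRight m EQ)
      ≈⟨ *-congˡ (det-cong EQ-br) ⟩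
    x ^ m * det (λ i j → scalar x i j + sum λ k → V i k * U k j)
      ∎
    where
    -U : Mat m n
    -U i j = - U i j

    -V : Mat n m
    -V i j = - V i j

    P : Matrix m
    P i j = scalar x i j + sum λ k → U i k * V k j

    Q E EQ : Matrix (m ℕ.+ n)
    Q = block (scalar x) -U V (scalar 1#)
    E = block (scalar 1#) 0ᴹ -V (scalar x)
    EQ = E *ᴹ Q

    Q-tl : ∀ i j → topLeft m Q i j ≡ scalar x i j
    Q-tl = block-topLeft (scalar x) -U V (scalar 1#)

    Q-tr : ∀ i j → topRight m Q i j ≡ -U i j
    Q-tr = block-topRight (scalar x) -U V (scalar 1#)

    Q-bl : ∀ i j → bottomLeft m Q i j ≡ V i j
    Q-bl = block-bottomLeft (scalar x) -U V (scalar 1#)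

    Q-br : ∀ i j → bottomRight m Q i j ≡ scalar 1# i j
    Q-br = block-bottomRight (scalar x) -U V (scalar 1#)

    det-Q : det Q ≈ det (schur m Q U)
    det-Q = begin
      det Q
        ≈⟨ det-schur m Q U (λ i j → trans
             (+-cong (reflexive (Q-tr i j))
                     (trans (sum-cong λ k → *-congˡ {U i k} (reflexive (Q-br k j))) (sum-1ʳ j (U i))))
             (-‿inverseˡ _)) ⟩
      det (schur m Q U) * det (bottomRight m Q)
        ≈⟨ *-congˡ (trans (det-cong λ i j → reflexive (Q-br i j)) (trans (det-scalar n 1#) (1^ n))) ⟩
      det (schur m Q U) * 1#
        ≈⟨ *-identityʳ _ ⟩
      det (schur m Q U)
        ∎

    det-E : det E ≈ x ^ n
    det-E = begin
      det E
        ≈⟨ det-lower-block m E (λ i j → reflexive (block-topRight (scalar 1#) 0ᴹ -V (scalar x) i j)) ⟩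
      det (topLeft m E) * det (bottomRight m E)
        ≈⟨ *-cong (det-cong λ i j → reflexive (block-topLeft (scalar 1#) 0ᴹ -V (scalar x) i j))
                  (det-cong λ i j → reflexive (block-bottomRight (scalar 1#) 0ᴹ -V (scalar x) i j)) ⟩
      det (scalar {m} 1#) * det (scalar {n} x)
        ≈⟨ *-cong (trans (det-scalar m 1#) (1^ m)) (det-scalar n x) ⟩
      1# * x ^ n
        ≈⟨ *-identityˡ _ ⟩
      x ^ n
        ∎

    EQ-tl : ∀ i j → topLeft m EQ i j ≈ scalar x i j
    EQ-tl i j = begin
      topLeft m EQ i j
        ≈⟨ block-*-top (scalar 1#) 0ᴹ -V (scalar x) Q i (j ↑ˡ n) ⟩
      sum (λ k → scalar 1# i k * topLeft m Q k j) + sum (λ k → 0ᴹ i k * bottomLeft m Q k j)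
        ≈⟨ +-cong (sum-1ˡ i (λ k → topLeft m Q k j)) (sum-0ᴹ (λ k → bottomLeft m Q k j) {i}) ⟩
      topLeft m Q i j + 0#
        ≈⟨ trans (+-identityʳ _) (reflexive (Q-tl i j)) ⟩
      scalar x i j
        ∎

    EQ-bl : ∀ i j → bottomLeft m EQ i j ≈ 0#
    EQ-bl i j = begin
      bottomLeft m EQ i j
        ≈⟨ block-*-bottom (scalar 1#) 0ᴹ -V (scalar x) Q i (j ↑ˡ n) ⟩
      sum (λ k → - V i k * topLeft m Q k j) + sum (λ k → scalar x i k * bottomLeft m Q k j)
        ≈⟨ +-cong (trans (sum-cong λ k → *-congˡ { - V i k } (reflexive (Q-tl k j))) (sum-scalarʳ x j (-V i)))
                  (trans (sum-scalarˡ x i (λ k → bottomLeft m Q k j)) (*-congˡ (reflexive (Q-bl i j)))) ⟩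
      - V i j * x + x * V i j
        ≈⟨ +-cong (sym (-‿distribˡ-* _ _)) (*-comm _ _) ⟩
      - (V i j * x) + V i j * x
        ≈⟨ -‿inverseˡ _ ⟩
      0#
        ∎

    EQ-br : ∀ i j → bottomRight m EQ i j ≈ scalar x i j + sum λ k → V i k * U k j
    EQ-br i j = begin
      bottomRight m EQ i j
        ≈⟨ block-*-bottom (scalar 1#) 0ᴹ -V (scalar x) Q i (m ↑ʳ j) ⟩
      sum (λ k → - V i k * topRight m Q k j) + sum (λ k → scalar x i k * bottomRight m Q k j)
        ≈⟨ +-cong (sum-cong λ k → trans (*-congˡ { - V i k } (reflexive (Q-tr k j))) (-x*-y (V i k) (U k j)))
                  (trans (sum-cong λ k → *-congˡ {scalar x i k} (reflexive (Q-br k j))) (sum-1ʳ j (scalar x i))) ⟩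
      sum (λ k → V i k * U k j) + scalar x i j
        ≈⟨ +-comm _ _ ⟩
      scalar x i j + sum (λ k → V i k * U k j)
        ∎
      where
      -x*-y : ∀ y z → - y * - z ≈ y * z
      -x*-y y z = trans (sym (-‿distribˡ-* _ _)) (trans (-‿cong (sym (-‿distribʳ-* _ _))) (-‿involutive _))

  sum-const : ∀ n x → sum {n} (λ _ → x) ≈ nat n * x
  sum-const n x = begin
    sum {n} (λ _ → x)  ≈⟨ sum-replicate n ⟩
    n × x              ≈⟨ ×-congʳ n (*-identityˡ x) ⟨
    n × (1# * x)       ≈⟨ ×-assoc-* n 1# x ⟨
    nat n * x          ∎

  -- The matrix `M` is x I + B ⊗ J with J all-ones of order n. With U = B ⊗ 1 and V = I ⊗ 1ᵀ it
  -- equals x I + U V, and V U = n B because 1ᵀ 1 = n.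
  det-⊗1 : ∀ x (B : Matrix m) (M : Matrix (m ℕ.* n)) →
    (∀ i j (p q : Fin n) → M (combine i p) (combine j q) ≈ scalar x (combine i p) (combine j q) + B i j) →
    x ^ m * det M ≈ x ^ (m ℕ.* n) * det (λ i j → scalar x i j + nat n * B i j)
  det-⊗1 {m} {n} x B M M≈ = begin
    x ^ m * det M
      ≈⟨ *-congˡ (det-cong M≈UV) ⟩
    x ^ m * det (λ u v → scalar x u v + sum λ k → U u k * V k v)
      ≈⟨ sylvester x U V ⟩
    x ^ (m ℕ.* n) * det (λ i j → scalar x i j + sum λ u → V i u * U u j)
      ≈⟨ *-congˡ (det-cong λ i j → +-congˡ {scalar x i j} (VU i j)) ⟩
    x ^ (m ℕ.* n) * det (λ i j → scalar x i j + nat n * B i j)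
      ∎
    where
    quotient-combine : ∀ i p → quotient n (combine i p) ≡ i
    quotient-combine i p = ≡.cong proj₁ (remQuot-combine {m} {n} i p)

    U : Mat (m ℕ.* n) m
    U u k = B (quotient n u) k

    V : Mat m (m ℕ.* n)
    V k v = scalar 1# k (quotient n v)

    M≈UV : ∀ u v → M u v ≈ scalar x u v + sum λ k → U u k * V k v
    M≈UV = combine-elim {m} _ λ i p → combine-elim {m} _ λ j q → trans (M≈ i j p q) (+-congˡ (sym (begin
      sum (λ k → U (combine i p) k * V k (combine j q))
        ≈⟨ sum-1ʳ (quotient n (combine j q)) (U (combine i p)) ⟩
      B (quotient n (combine i p)) (quotient n (combine j q))
        ≡⟨ ≡.cong₂ B (quotient-combine i p) (quotient-combine j q) ⟩
      B i j
        ∎)))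

    VU : ∀ i j → sum (λ u → V i u * U u j) ≈ nat n * B i j
    VU i j = begin
      sum (λ u → V i u * U u j)
        ≈⟨ sum-combine m n (λ u → V i u * U u j) ⟩
      sum {m} (λ k → sum {n} λ p → V i (combine k p) * U (combine k p) j)
        ≈⟨ sum-cong {m} (λ k → sum-cong {n} λ p → reflexive (≡.cong (λ k → scalar 1# i k * B k j) (quotient-combine k p))) ⟩
      sum (λ k → sum {n} λ _ → scalar 1# i k * B k j)
        ≈⟨ ∑-comm {m} {n} (λ k _ → scalar 1# i k * B k j) ⟩
      sum {n} (λ _ → sum λ k → scalar 1# i k * B k j)
        ≈⟨ sum-cong {n} (λ _ → sum-1ˡ i (λ k → B k j)) ⟩
      sum {n} (λ _ → B i j)
        ≈⟨ sum-const n (B i j) ⟩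
      nat n * B i j
        ∎

  -- Inverses of symmetric matrices; degrees as row sums

  *ᴹ-assoc : (A B C : Matrix n) → ((A *ᴹ B) *ᴹ C) ≈ᴹ (A *ᴹ (B *ᴹ C))
  *ᴹ-assoc A B C i j = begin
    sum (λ k → sum (λ l → A i l * B l k) * C k j)
      ≈⟨ sum-cong (λ k → trans (*-distribʳ-sum (C k j) (λ l → A i l * B l k))
                               (sum-cong λ l → *-assoc (A i l) (B l k) (C k j))) ⟩
    sum (λ k → sum (λ l → A i l * (B l k * C k j)))
      ≈⟨ ∑-comm (λ k l → A i l * (B l k * C k j)) ⟩
    sum (λ l → sum (λ k → A i l * (B l k * C k j)))
      ≈⟨ sum-cong (λ l → *-distribˡ-sum (A i l) (λ k → B l k * C k j)) ⟨
    sum (λ l → A i l * sum (λ k → B l k * C k j))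
      ∎

  scalar-* : ∀ x y (i j : Fin n) → scalar x i j * y ≈ scalar (x * y) i j
  scalar-* x y i j with does (i ≟ j)
  ... | true  = refl
  ... | false = zeroˡ y

  diagonal-sym : (d : Vector Carrier n) → ∀ i j → diagonal d i j ≈ diagonal d j i
  diagonal-sym d zero    zero    = refl
  diagonal-sym d zero    (suc j) = refl
  diagonal-sym d (suc i) zero    = refl
  diagonal-sym d (suc i) (suc j) = diagonal-sym (d ∘ suc) i j

  -- For symmetric M the transpose of a right inverse is a left inverse.
  symmetric-invertible : (M : Matrix n) → (∀ i j → M i j ≈ M j i) →
    ∀ {d} → det M * d ≈ 1# → Invertibleᴹ M
  symmetric-invertible M M-sym {d} detM*d≈1 = N , N*M≈1 , M*N≈1
    where
    N Nᵀ : Matrix _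
    N i j = adjugate M i j * d
    Nᵀ i j = N j i

    M*N≈1 : (M *ᴹ N) ≈ᴹ scalar 1#
    M*N≈1 i j = begin
      sum (λ k → M i k * (adjugate M k j * d))
        ≈⟨ sum-cong (λ k → *-assoc (M i k) (adjugate M k j) d) ⟨
      sum (λ k → M i k * adjugate M k j * d)
        ≈⟨ *-distribʳ-sum d (λ k → M i k * adjugate M k j) ⟨
      sum (λ k → M i k * adjugate M k j) * d
        ≈⟨ *-congʳ (*-adjugate M i j) ⟩
      scalar (det M) i j * d
        ≈⟨ scalar-* (det M) d i j ⟩
      scalar (det M * d) i j
        ≈⟨ diagonal-cong (λ _ → detM*d≈1) i j ⟩
      scalar 1# i j
        ∎

    Nᵀ*M≈1 : (Nᵀ *ᴹ M) ≈ᴹ scalar 1#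
    Nᵀ*M≈1 i j = begin
      sum (λ k → N k i * M k j)  ≈⟨ sum-cong (λ k → trans (*-comm (N k i) (M k j)) (*-congʳ (M-sym k j))) ⟩
      sum (λ k → M j k * N k i)  ≈⟨ M*N≈1 j i ⟩
      scalar 1# j i              ≈⟨ diagonal-sym (λ _ → 1#) j i ⟩
      scalar 1# i j              ∎

    Nᵀ≈N : Nᵀ ≈ᴹ N
    Nᵀ≈N i j = begin
      Nᵀ i j                  ≈⟨ sum-1ʳ j (Nᵀ i) ⟨
      sum (λ k → Nᵀ i k * scalar 1# k j)  ≈⟨ sum-cong (λ k → *-congˡ {Nᵀ i k} (M*N≈1 k j)) ⟨
      (Nᵀ *ᴹ (M *ᴹ N)) i j    ≈⟨ *ᴹ-assoc Nᵀ M N i j ⟨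
      ((Nᵀ *ᴹ M) *ᴹ N) i j    ≈⟨ sum-cong (λ k → *-congʳ {N k j} (Nᵀ*M≈1 i k)) ⟩
      sum (λ k → scalar 1# i k * N k j)   ≈⟨ sum-1ˡ i (λ k → N k j) ⟩
      N i j                   ∎

    N*M≈1 : (N *ᴹ M) ≈ᴹ scalar 1#
    N*M≈1 i j = trans (sum-cong λ k → *-congʳ {M k j} (sym (Nᵀ≈N i k))) (Nᵀ*M≈1 i j)

  adjacency-sym : (G : Graph n) → ∀ i j → adjacency G i j ≈ adjacency G j i
  adjacency-sym G i j with Graph.E? G i j | Graph.E? G j i
  ... | yes _   | yes _   = refl
  ... | yes Eij | no ¬Eji = contradiction (Graph.sym G Eij) ¬Eji
  ... | no ¬Eij | yes Eji = contradiction (Graph.sym G Eji) ¬Eij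
  ... | no _    | no _    = refl

  laplacian-invertible : (G : Graph n) → ∀ t {d} → f (laplacian G) t * d ≈ 1# →
    Invertibleᴹ (scalar t -ᴹ laplacian G)
  laplacian-invertible G t = symmetric-invertible (scalar t -ᴹ laplacian G) λ i j →
    +-cong (diagonal-sym (λ _ → t) i j)
      (-‿cong (+-cong (diagonal-sym (λ k → nat (Graph.degree G k)) i j) (-‿cong (adjacency-sym G i j))))

  -‿+ : ∀ x y → - (x + y) ≈ - x + - y
  -‿+ x y = sym (-‿+-comm x y)

  -[x-y] : ∀ x y → - (x - y) ≈ - x + y
  -[x-y] x y = trans (-‿+ x (- y)) (+-congˡ (-‿involutive y))

  -x*[y-z] : ∀ x y z → - (x * (y - z)) ≈ - (x * y) + x * z
  -x*[y-z] x y z = trans (-‿cong (x[y-z]≈xy-xz x y z)) (-[x-y] (x * y) (x * z))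

  scalar-diagonal : ∀ x (d : Vector Carrier n) y i j →
    scalar x i j - (diagonal d i j - y) ≈ diagonal (λ k → x - d k) i j + y
  scalar-diagonal x d y i j with does (i ≟ j)
  ... | true  = trans (+-congˡ (-[x-y] (d i) y)) (sym (+-assoc _ _ _))
  ... | false = +-congˡ (trans (-[x-y] 0# y) (trans (+-congʳ -0#≈0#) (+-identityˡ y)))

  nat-sum : (v : Vector ℕ n) → nat (sumℕ v) ≈ sum (λ i → nat (v i))
  nat-sum {zero}  v = refl
  nat-sum {suc n} v = trans (×-homo-+ 1# (v zero) (sumℕ (tail v))) (+-congˡ (nat-sum (tail v)))

  -- As row sums of the adjacency matrix, degrees can be computed block by block in the product
  -- graph.
  nat-degree : (G : Graph n) → ∀ i → nat (Graph.degree G i) ≈ sum (adjacency G i)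
  nat-degree G i = trans (nat-sum (λ j → if does (Graph.E? G i j) then 1 else 0))
                         (sum-cong λ j → nat-if (does (Graph.E? G i j)))
    where
    nat-if : ∀ e → nat (if e then 1 else 0) ≈ (if e then 1# else 0#)
    nat-if true  = +-identityʳ 1#
    nat-if false = refl

  sum-combine-const : (F : Fin (m ℕ.* n) → Carrier) (h : Vector Carrier m) →
    (∀ k q → F (combine k q) ≈ h k) → sum F ≈ nat n * sum h
  sum-combine-const {m} {n} F h F≈h = begin
    sum F                                   ≈⟨ sum-combine m n F ⟩
    sum {m} (λ k → sum {n} λ q → F (combine k q))  ≈⟨ sum-cong (λ k → trans (sum-cong (F≈h k)) (sum-const n (h k))) ⟩
    sum (λ k → nat n * h k)                 ≈⟨ *-distribˡ-sum (nat n) h ⟨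
    nat n * sum h                           ∎

  -- A row of a block diagonal matrix meets only the block of its own index `i`.
  sum-combine-scalar : (F : Fin (m ℕ.* n) → Carrier) (i : Fin m) (g : Mat m n) →
    (∀ k q → F (combine k q) ≈ scalar 1# i k * g k q) → sum F ≈ sum (g i)
  sum-combine-scalar {m} {n} F i g F≈g = begin
    sum F
      ≈⟨ sum-combine m n F ⟩
    sum {m} (λ k → sum {n} λ q → F (combine k q))
      ≈⟨ sum-cong (λ k → trans (sum-cong (F≈g k)) (sym (*-distribˡ-sum (scalar 1# i k) (g k)))) ⟩
    sum (λ k → scalar 1# i k * sum (g k))
      ≈⟨ sum-1ˡ i (λ k → sum (g k)) ⟩
    sum (g i)
      ∎

  -- The Laplacian matrix of the product graph

  module ProductGraph (G₁ : Graph m) (G₂ : Graph n) where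
    private
      mn : ℕ
      mn = m ℕ.* n

      adj : Vertex m n → Vertex m n → Carrier
      adj u v = if does (edge? G₁ G₂ u v) then 1# else 0#

      -- This is `vertex` as a function of the outcome of `splitAt`, so that facts about that
      -- outcome can be substituted by congruence.
      vertex′ : Fin mn ⊎ Fin mn → Vertex m n
      vertex′ = [ (λ u → uncurry a (remQuot n u)) , (λ u → uncurry b (remQuot n u)) ]′

      A : Matrix (mn ℕ.+ mn)
      A = adjacency (G₁ ⊛ G₂)

      A₁ : Matrix m
      A₁ = adjacency G₁

      A₂ : Matrix n
      A₂ = adjacency G₂

      deg : Vector Carrier (mn ℕ.+ mn)
      deg u = nat (Graph.degree (G₁ ⊛ G₂) u)

    vertex-a : ∀ i p → vertex {m} {n} (combine i p ↑ˡ mn) ≡ a i p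
    vertex-a i p = ≡.trans (≡.cong vertex′ (splitAt-↑ˡ mn (combine i p) mn)) (≡.cong (uncurry a) (remQuot-combine i p))

    vertex-b : ∀ i p → vertex {m} {n} (mn ↑ʳ combine i p) ≡ b i p
    vertex-b i p = ≡.trans (≡.cong vertex′ (splitAt-↑ʳ mn mn (combine i p))) (≡.cong (uncurry b) (remQuot-combine i p))

    -- Once the numbers are turned back into vertices `a i p` and `b i p`, three of the four blocks
    -- agree by computation. The block between two `b` vertices needs the case split that `edge?`
    -- itself makes.
    A-topLeft : ∀ i j p q → topLeft mn A (combine i p) (combine j q) ≈ A₁ i j
    A-topLeft i j p q = reflexive (≡.cong₂ adj (vertex-a i p) (vertex-a j q))

    A-topRight : ∀ i j p q → topRight mn A (combine i p) (combine j q) ≈ scalar 1# i j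
    A-topRight i j p q = reflexive (≡.cong₂ adj (vertex-a i p) (vertex-b j q))

    A-bottomLeft : ∀ i j p q → bottomLeft mn A (combine i p) (combine j q) ≈ scalar 1# i j
    A-bottomLeft i j p q = reflexive (≡.cong₂ adj (vertex-b i p) (vertex-a j q))

    A-bottomRight : ∀ i j p q → bottomRight mn A (combine i p) (combine j q) ≈ scalar (A₂ p q) i j
    A-bottomRight i j p q = trans (reflexive (≡.cong₂ adj (vertex-b i p) (vertex-b j q))) lemma
      where
      lemma : adj (b i p) (b j q) ≈ scalar (A₂ p q) i j
      lemma with i ≟ j
      ... | yes ≡.refl = refl
      ... | no  _      = refl

    degree-a : ∀ {r} → Regular r G₁ → ∀ i p → deg (combine i p ↑ˡ mn) ≈ nat (r ℕ.* n) + nat n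
    degree-a {r} reg i p = begin
      deg u
        ≈⟨ nat-degree (G₁ ⊛ G₂) u ⟩
      sum (A u)
        ≈⟨ sum-↑ mn (A u) ⟩
      sum (topLeft mn A (combine i p)) + sum (topRight mn A (combine i p))
        ≈⟨ +-cong (sum-combine-const (topLeft mn A (combine i p)) (A₁ i) λ k q → A-topLeft i k p q)
                  (sum-combine-scalar (topRight mn A (combine i p)) i (λ _ _ → 1#) λ k q →
                     trans (A-topRight i k p q) (sym (*-identityʳ _))) ⟩
      nat n * sum (A₁ i) + sum {n} (λ _ → 1#)
        ≈⟨ +-cong (*-congˡ (trans (sym (nat-degree G₁ i)) (reflexive (≡.cong nat (reg i))))) (sum-replicate n) ⟩
      nat n * nat r + nat n
        ≈⟨ +-congʳ (trans (*-comm _ _) (sym (×1-homo-* r n))) ⟩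
      nat (r ℕ.* n) + nat n
        ∎
      where
      u : Fin (mn ℕ.+ mn)
      u = combine i p ↑ˡ mn

    degree-b : ∀ i p → deg (mn ↑ʳ combine i p) ≈ nat n + nat (Graph.degree G₂ p)
    degree-b i p = begin
      deg u
        ≈⟨ nat-degree (G₁ ⊛ G₂) u ⟩
      sum (A u)
        ≈⟨ sum-↑ mn (A u) ⟩
      sum (bottomLeft mn A (combine i p)) + sum (bottomRight mn A (combine i p))
        ≈⟨ +-cong (sum-combine-scalar (bottomLeft mn A (combine i p)) i (λ _ _ → 1#) λ k q →
                     trans (A-bottomLeft i k p q) (sym (*-identityʳ _)))
                  (sum-combine-scalar (bottomRight mn A (combine i p)) i (λ _ → A₂ p) λ k q →
                     trans (A-bottomRight i k p q) (scalar-1* (A₂ p q) i k)) ⟩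
      sum {n} (λ _ → 1#) + sum (A₂ p)
        ≈⟨ +-cong (sum-replicate n) (sym (nat-degree G₂ p)) ⟩
      nat n + nat (Graph.degree G₂ p)
        ∎
      where
      u : Fin (mn ℕ.+ mn)
      u = mn ↑ʳ combine i p

    module _ (r : ℕ) (regular : Regular r G₁) (x : Carrier) (N : Matrix n)
      (inverse : (N *ᴹ (scalar (x - nat n) -ᴹ laplacian G₂)) ≈ᴹ scalar 1#) where
      private
        t y χ : Carrier
        t = x - nat (r ℕ.* n) - nat n
        y = x - nat n
        χ = sum λ i → sum λ j → N i j

        S : Matrix n
        S = scalar y -ᴹ laplacian G₂

        T : Matrix (mn ℕ.+ mn)
        T = scalar x -ᴹ laplacian (G₁ ⊛ G₂)

        D : Vector Carrier (mn ℕ.+ mn)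
        D u = x - deg u

        -- The row vector -1ᵀ N, that is, one row of -J N. As `N` is a left inverse of `S`, it
        -- satisfies s S = -1ᵀ, and its entries add up to -χ.
        s : Vector Carrier n
        s q = - sum λ i → N i q

        B : Matrix m
        B i j = A₁ i j + scalar 1# i j * - χ

        -- -I ⊗ (J N), with J the all-ones matrix.
        W : Matrix mn
        W u v = scalar 1# (quotient {m} n u) (quotient {m} n v) * s (remainder {m} n v)

      x-[y+z] : ∀ y z → x - (y + z) ≈ x - y - z
      x-[y+z] y z = trans (+-congˡ (-‿+ y z)) (sym (+-assoc _ _ _))

      T≈ : ∀ u v → T u v ≈ diagonal D u v + A u v
      T≈ u v = scalar-diagonal x deg (A u v) u v

      T-topLeft : ∀ i j p q → topLeft mn T (combine i p) (combine j q) ≈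
        scalar t (combine i p) (combine j q) + A₁ i j
      T-topLeft i j p q = begin
        topLeft mn T (combine i p) (combine j q)
          ≈⟨ T≈ _ _ ⟩
        diagonal D (combine i p ↑ˡ mn) (combine j q ↑ˡ mn) + topLeft mn A (combine i p) (combine j q)
          ≈⟨ +-cong (reflexive (diagonal-↑ˡ mn D (combine i p) (combine j q))) (A-topLeft i j p q) ⟩
        diagonal (λ u → D (u ↑ˡ mn)) (combine i p) (combine j q) + A₁ i j
          ≈⟨ +-congʳ (diagonal-cong (combine-elim {m} (λ u → D (u ↑ˡ mn) ≈ t) λ i p →
               trans (+-congˡ (-‿cong (degree-a regular i p))) (x-[y+z] _ _)) (combine i p) (combine j q)) ⟩
        scalar t (combine i p) (combine j q) + A₁ i j
          ∎

      T-topRight : ∀ i j p q → topRight mn T (combine i p) (combine j q) ≈ scalar 1# i j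
      T-topRight i j p q = trans (T≈ _ _) (trans
        (+-cong (reflexive (diagonal-↑ˡ↑ʳ D (combine i p) (combine j q))) (A-topRight i j p q)) (+-identityˡ _))

      T-bottomLeft : ∀ i j p q → bottomLeft mn T (combine i p) (combine j q) ≈ scalar 1# i j
      T-bottomLeft i j p q = trans (T≈ _ _) (trans
        (+-cong (reflexive (diagonal-↑ʳ↑ˡ D (combine i p) (combine j q))) (A-bottomLeft i j p q)) (+-identityˡ _))

      T-bottomRight : ∀ i j p q → bottomRight mn T (combine i p) (combine j q) ≈ scalar (S p q) i j
      T-bottomRight i j p q = begin
        bottomRight mn T (combine i p) (combine j q)
          ≈⟨ T≈ _ _ ⟩
        diagonal D (mn ↑ʳ combine i p) (mn ↑ʳ combine j q) + bottomRight mn A (combine i p) (combine j q)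
          ≈⟨ +-cong (reflexive (≡.trans (diagonal-↑ʳ mn D (combine i p) (combine j q))
                                        (diagonal-combine (λ u → D (mn ↑ʳ u)) i j p q)))
                    (A-bottomRight i j p q) ⟩
        scalar (diagonal (λ p → D (mn ↑ʳ combine i p)) p q) i j + scalar (A₂ p q) i j
          ≈⟨ scalar-+ _ _ ⟩
        scalar (diagonal (λ p → D (mn ↑ʳ combine i p)) p q + A₂ p q) i j
          ≈⟨ diagonal-cong (λ _ → +-congʳ (diagonal-cong (λ p →
               trans (+-congˡ (-‿cong (degree-b i p))) (x-[y+z] _ _)) p q)) i j ⟩
        scalar (diagonal (λ p → y - nat (Graph.degree G₂ p)) p q + A₂ p q) i j
          ≈⟨ diagonal-cong (λ _ → scalar-diagonal y (λ p → nat (Graph.degree G₂ p)) (A₂ p q) p q) i j ⟨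
        scalar (S p q) i j
          ∎
        where
        scalar-+ : ∀ v w → scalar v i j + scalar w i j ≈ scalar (v + w) i j
        scalar-+ v w with does (i ≟ j)
        ... | true  = refl
        ... | false = +-identityˡ 0#

      -- A row of `W` is multiplied by a column e_j ⊗ g. Taking a column of `S` for g serves the
      -- lower right block, the all-ones vector the lower left one.
      W-* : ∀ i j p (F : Vector Carrier mn) (g : Vector Carrier n) →
        (∀ k q → F (combine k q) ≈ scalar 1# k j * g q) →
        sum (λ v → W (combine i p) v * F v) ≈ scalar 1# i j * sum (λ q → s q * g q)
      W-* i j p F g F≈g = begin
        sum (λ v → W (combine i p) v * F v)
          ≈⟨ sum-combine-scalar {m} {n} (λ v → W (combine i p) v * F v) i (λ k q → s q * (scalar 1# k j * g q)) (λ k q →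
               trans (*-cong (reflexive (≡.cong₂ (λ i k → scalar 1# i (proj₁ k) * s (proj₂ k))
                                                 (≡.cong proj₁ (remQuot-combine {m} {n} i p))
                                                 (remQuot-combine {m} {n} k q))) (F≈g k q))
                     (*-assoc _ _ _)) ⟩
        sum (λ q → s q * (scalar 1# i j * g q))
          ≈⟨ sum-cong (λ q → x∙yz≈y∙xz (s q) (scalar 1# i j) (g q)) ⟩
        sum (λ q → scalar 1# i j * (s q * g q))
          ≈⟨ *-distribˡ-sum (scalar 1# i j) (λ q → s q * g q) ⟨
        scalar 1# i j * sum (λ q → s q * g q)
          ∎

      sum-neg : (v : Vector Carrier p) → sum (λ i → - v i) ≈ - sum v
      sum-neg v = begin
        sum (λ i → - v i)       ≈⟨ sum-cong (λ i → -1*x≈-x (v i)) ⟨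
        sum (λ i → - 1# * v i)  ≈⟨ *-distribˡ-sum (- 1#) v ⟨
        - 1# * sum v            ≈⟨ -1*x≈-x _ ⟩
        - sum v                 ∎

      sum-s : sum (λ q → s q * 1#) ≈ - χ
      sum-s = begin
        sum (λ q → s q * 1#)  ≈⟨ sum-cong (λ q → *-identityʳ (s q)) ⟩
        sum s                 ≈⟨ sum-neg (λ q → sum λ i → N i q) ⟩
        - sum (λ q → sum λ i → N i q)  ≈⟨ -‿cong (∑-comm (λ q i → N i q)) ⟩
        - χ                   ∎

      s*S : ∀ l → sum (λ q → s q * S q l) ≈ - 1#
      s*S l = begin
        sum (λ q → - sum (λ i → N i q) * S q l)
          ≈⟨ sum-cong (λ q → trans (sym (-‿distribˡ-* _ _)) (-‿cong (*-distribʳ-sum (S q l) (λ i → N i q)))) ⟩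
        sum (λ q → - sum (λ i → N i q * S q l))
          ≈⟨ sum-neg (λ q → sum (λ i → N i q * S q l)) ⟩
        - sum (λ q → sum (λ i → N i q * S q l))
          ≈⟨ -‿cong (trans (∑-comm (λ q i → N i q * S q l)) (sum-cong λ i → inverse i l)) ⟩
        - sum (λ i → scalar 1# i l)
          ≈⟨ -‿cong (trans (sum-cong λ i → sym (*-identityˡ (scalar 1# i l))) (sum-1ʳ l (λ _ → 1#))) ⟩
        - 1#
          ∎

      -- Within a diagonal block this is J - J N S = 0.
      W-eliminates : ∀ u v → topRight mn T u v + sum (λ w → W u w * bottomRight mn T w v) ≈ 0#
      W-eliminates = combine-elim {m} _ λ i p → combine-elim {m} _ λ j l → begin
        topRight mn T (combine i p) (combine j l) + sum (λ w → W (combine i p) w * bottomRight mn T w (combine j l))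
          ≈⟨ +-cong (T-topRight i j p l)
                    (trans (W-* i j p (λ w → bottomRight mn T w (combine j l)) (λ q → S q l)
                              (λ k q → trans (T-bottomRight k j q l) (scalar-1* (S q l) k j)))
                           (*-congˡ (s*S l))) ⟩
        scalar 1# i j + scalar 1# i j * - 1#
          ≈⟨ +-congˡ (trans (*-comm _ _) (-1*x≈-x _)) ⟩
        scalar 1# i j - scalar 1# i j
          ≈⟨ -‿inverseʳ _ ⟩
        0#
          ∎

      schur-T : ∀ i j p q → schur mn T W (combine i p) (combine j q) ≈
        scalar t (combine i p) (combine j q) + B i j
      schur-T i j p q = trans
        (+-cong (T-topLeft i j p q)
                (trans (W-* i j p (λ w → bottomLeft mn T w (combine j q)) (λ _ → 1#)
                          (λ k l → trans (T-bottomLeft k j l q) (sym (*-identityʳ _))))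
                       (*-congˡ sum-s)))
        (+-assoc _ _ _)

      -- On the diagonal, regularity of `G₁` turns the summand -r n of `t` into the degree part of
      -- -n L₁; together with n A₁ it makes up -n L₁.
      reduced : ∀ i j → scalar t i j + nat n * B i j ≈
        scalar (y - nat n * χ) i j - nat n * laplacian G₁ i j
      reduced i j with i ≟ j
      ... | yes ≡.refl = begin
        t + nat n * (A₁ i i + 1# * - χ)
          ≈⟨ +-congˡ (trans (distribˡ _ _ _) (+-congˡ (trans (*-congˡ (*-identityˡ _)) (sym (-‿distribʳ-* _ _))))) ⟩
        x - nat (r ℕ.* n) - nat n + (nat n * A₁ i i - nat n * χ)
          ≈⟨ solve 5 (λ x z w u v → ((x ⊕ z) ⊕ w) ⊕ (u ⊕ v) ⊜ ((x ⊕ w) ⊕ v) ⊕ (z ⊕ u)) refl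
               x (- nat (r ℕ.* n)) (- nat n) (nat n * A₁ i i) (- (nat n * χ)) ⟩
        y - nat n * χ + (- nat (r ℕ.* n) + nat n * A₁ i i)
          ≈⟨ +-congˡ (+-congʳ (-‿cong (trans (×1-homo-* r n)
               (trans (*-comm _ _) (*-congˡ (reflexive (≡.cong nat (≡.sym (regular i))))))))) ⟩
        y - nat n * χ + (- (nat n * nat (Graph.degree G₁ i)) + nat n * A₁ i i)
          ≈⟨ +-congˡ (-x*[y-z] (nat n) _ _) ⟨
        y - nat n * χ - nat n * (nat (Graph.degree G₁ i) - A₁ i i)
          ∎
      ... | no  _      = +-congˡ (begin
        nat n * (A₁ i j + 0# * - χ)    ≈⟨ *-congˡ (trans (+-congˡ (zeroˡ _)) (+-identityʳ _)) ⟩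
        nat n * A₁ i j                 ≈⟨ +-identityˡ _ ⟨
        0# + nat n * A₁ i j            ≈⟨ +-congʳ (trans (-‿cong (zeroʳ _)) -0#≈0#) ⟨
        - (nat n * 0#) + nat n * A₁ i j  ≈⟨ -x*[y-z] (nat n) _ _ ⟨
        - (nat n * (0# - A₁ i j))      ∎)

      -- Over a ring `t` may be a zero divisor, so the factor t^m from `det-⊗1` stays on the left.
      -- Splitting m n as m + m (n - 1), possible because n is positive, produces the same factor on
      -- the right.
      det-T : .{{_ : NonZero n}} → t ^ m * det T ≈
        t ^ m * (t ^ (m ℕ.* (n ∸ 1)) * det S ^ m
                  * det (λ i j → scalar (y - nat n * χ) i j - nat n * laplacian G₁ i j))
      det-T = begin
        t ^ m * det T
          ≈⟨ *-congˡ (det-schur mn T W W-eliminates) ⟩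
        t ^ m * (det (schur mn T W) * det (bottomRight mn T))
          ≈⟨ *-assoc _ _ _ ⟨
        t ^ m * det (schur mn T W) * det (bottomRight mn T)
          ≈⟨ *-cong (det-⊗1 {m} {n} t B (schur mn T W) schur-T) (det-⊗ m S (bottomRight mn T) T-bottomRight) ⟩
        t ^ (m ℕ.* n) * det (λ i j → scalar t i j + nat n * B i j) * det S ^ m
          ≈⟨ *-congʳ (*-cong (trans (reflexive (≡.cong (t ^_) m*n≡)) (^-homo-* t m (m ℕ.* (n ∸ 1))))
                             (det-cong reduced)) ⟩
        t ^ m * t ^ (m ℕ.* (n ∸ 1)) * detR * det S ^ m
          ≈⟨ trans (*-assoc _ _ _) (trans (*-assoc _ _ _) (*-congˡ (trans (*-congˡ (*-comm _ _)) (sym (*-assoc _ _ _))))) ⟩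
        t ^ m * (t ^ (m ℕ.* (n ∸ 1)) * det S ^ m * detR)
          ∎
        where
        detR : Carrier
        detR = det (λ i j → scalar (y - nat n * χ) i j - nat n * laplacian G₁ i j)

        m*n≡ : m ℕ.* n ≡ m ℕ.+ m ℕ.* (n ∸ 1)
        m*n≡ = ≡.trans (≡.cong (m ℕ.*_) (≡.sym (ℕ.suc-pred n))) (ℕ.*-suc m (n ∸ 1))

      -- The characteristic polynomial of n L₁ at y - n χ is read off that of L₁ at z = (y - n χ) / n.
      product-formula : .{{_ : NonZero n}} → ∀ {t⁻¹ n⁻¹} → t * t⁻¹ ≈ 1# → nat n * n⁻¹ ≈ 1# →
        (μ : Vector Carrier m) → (∀ z → f (laplacian G₁) z ≈ product λ i → z - μ i) →
        f (laplacian (G₁ ⊛ G₂)) x ≈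
          t ^ (m ℕ.* (n ∸ 1)) * f (laplacian G₂) y ^ m * product (λ i → x - nat n - nat n * μ i - nat n * χ)
      product-formula {t⁻¹} {n⁻¹} tt⁻¹≈1 nn⁻¹≈1 μ charpoly = trans
        (^-cancel m tt⁻¹≈1 det-T)
        (*-congˡ (begin
          det (λ i j → scalar (y - nat n * χ) i j - nat n * laplacian G₁ i j)
            ≈⟨ det-cong entry ⟩
          det (λ i j → nat n * (scalar z -ᴹ laplacian G₁) i j)
            ≈⟨ det-scale m (nat n) (scalar z -ᴹ laplacian G₁) ⟩
          nat n ^ m * f (laplacian G₁) z
            ≈⟨ *-congˡ (charpoly z) ⟩
          nat n ^ m * product (λ i → z - μ i)
            ≈⟨ product-scale (nat n) (λ i → z - μ i) ⟨
          product (λ i → nat n * (z - μ i))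
            ≈⟨ product-cong (λ i → trans (x[y-z]≈xy-xz (nat n) z (μ i))
                 (trans (+-congʳ n*z) (x+y+z≈x+z+y y _ _))) ⟩
          product (λ i → y - nat n * μ i - nat n * χ)
            ∎))
        where
        z : Carrier
        z = (y - nat n * χ) * n⁻¹

        n*z : nat n * z ≈ y - nat n * χ
        n*z = begin
          nat n * z                          ≈⟨ x∙yz≈y∙xz _ _ _ ⟩
          (y - nat n * χ) * (nat n * n⁻¹)    ≈⟨ *-congˡ nn⁻¹≈1 ⟩
          (y - nat n * χ) * 1#               ≈⟨ *-identityʳ _ ⟩
          y - nat n * χ                      ∎

        x+y+z≈x+z+y : ∀ u v w → u + v + w ≈ u + w + v
        x+y+z≈x+z+y u v w = trans (+-assoc _ _ _) (trans (+-congˡ (+-comm v w)) (sym (+-assoc _ _ _)))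

        entry : ∀ i j → scalar (y - nat n * χ) i j - nat n * laplacian G₁ i j ≈
          nat n * (scalar z i j - laplacian G₁ i j)
        entry i j = sym (trans (x[y-z]≈xy-xz (nat n) (scalar z i j) (laplacian G₁ i j)) (+-congʳ (begin
          nat n * scalar z i j              ≈⟨ *-congˡ (scalar-1* z i j) ⟩
          nat n * (scalar 1# i j * z)       ≈⟨ x∙yz≈y∙xz _ _ _ ⟩
          scalar 1# i j * (nat n * z)       ≈⟨ *-congˡ n*z ⟩
          scalar 1# i j * (y - nat n * χ)   ≈⟨ scalar-1* _ i j ⟨
          scalar (y - nat n * χ) i j        ∎)))

        product-scale : ∀ x (v : Vector Carrier p) → product (λ i → x * v i) ≈ x ^ p * product v
        product-scale {zero}  x v = sym (*-identityˡ 1#)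
        product-scale {suc p} x v = trans (*-congˡ (product-scale x (v ∘ suc))) (*-interchange _ _ _ _)

        *-cancel : ∀ {u u⁻¹ v w} → u * u⁻¹ ≈ 1# → u * v ≈ u * w → v ≈ w
        *-cancel {u} {u⁻¹} {v} {w} uu⁻¹≈1 uv≈uw = begin
          v              ≈⟨ expand v ⟨
          u⁻¹ * (u * v)  ≈⟨ *-congˡ uv≈uw ⟩
          u⁻¹ * (u * w)  ≈⟨ expand w ⟩
          w              ∎
          where
          expand : ∀ v → u⁻¹ * (u * v) ≈ v
          expand v = trans (x∙yz≈yx∙z _ _ _) (trans (*-congʳ uu⁻¹≈1) (*-identityˡ v))

        ^-cancel : ∀ k {u u⁻¹ v w} → u * u⁻¹ ≈ 1# → u ^ k * v ≈ u ^ k * w → v ≈ w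
        ^-cancel zero    uu⁻¹≈1 eq = trans (sym (*-identityˡ _)) (trans eq (*-identityˡ _))
        ^-cancel (suc k) uu⁻¹≈1 eq = ^-cancel k uu⁻¹≈1
          (*-cancel uu⁻¹≈1 (trans (sym (*-assoc _ _ _)) (trans eq (*-assoc _ _ _))))

-- Ring homomorphisms preserve determinants and Laplacian matrices

module _ {R : RawRing c ℓ} {S : RawRing c′ ℓ′} where
  private
    module R = RawRing R
    module S = RawRing S

  isRingHomomorphism : {φ : R.Carrier → S.Carrier} → (∀ {x y} → x R.≈ y → φ x S.≈ φ y) →
    (∀ x y → φ (x R.+ y) S.≈ φ x S.+ φ y) → φ R.0# S.≈ S.0# →
    (∀ x y → φ (x R.* y) S.≈ φ x S.* φ y) → φ R.1# S.≈ S.1# →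
    (∀ x → φ (R.- x) S.≈ S.- φ x) → IsRingHomomorphism R S φ
  isRingHomomorphism cong +-homo 0-homo *-homo 1-homo -‿homo = record
    { isSemiringHomomorphism = record
      { isNearSemiringHomomorphism = record
        { +-isMonoidHomomorphism = record
          { isMagmaHomomorphism = record { isRelHomomorphism = record { cong = cong } ; homo = +-homo }
          ; ε-homo = 0-homo
          }
        ; *-homo = *-homo
        }
      ; 1#-homo = 1-homo
      }
    ; -‿homo = -‿homo
    }

module Homomorphism (R : RawRing c ℓ) (S : CommutativeRing c′ ℓ′) (φ : RawRing.Carrier R → CommutativeRing.Carrier S)
  (isHomomorphism : IsRingHomomorphism R (CommutativeRing.rawRing S) φ) where
  private
    module R = Matrices R
    module M = Matrices (CommutativeRing.rawRing S)
  open CommutativeRing S hiding (zero)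
  open Determinants S using (det-cong; sum-cong)
  open IsRingHomomorphism isHomomorphism using (+-homo; *-homo; 0#-homo; 1#-homo; -‿homo)

  sum-homo : (v : Vector R.Carrier n) → φ (R.sum v) ≈ M.sum (φ ∘ v)
  sum-homo {zero}  v = 0#-homo
  sum-homo {suc n} v = trans (+-homo _ _) (+-congˡ (sum-homo (tail v)))

  product-homo : (v : Vector R.Carrier n) → φ (R.product v) ≈ M.product (φ ∘ v)
  product-homo {zero}  v = 1#-homo
  product-homo {suc n} v = trans (*-homo _ _) (*-congˡ (product-homo (tail v)))

  nat-homo : ∀ k → φ (R.nat k) ≈ M.nat k
  nat-homo zero    = 0#-homo
  nat-homo (suc k) = trans (+-homo _ _) (+-cong 1#-homo (nat-homo k))

  sub-homo : ∀ x y → φ (x R.- y) ≈ φ x M.- φ y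
  sub-homo x y = trans (+-homo _ _) (+-congˡ (-‿homo y))

  diagonal-homo : (d : Vector R.Carrier n) → ∀ i j → φ (R.diagonal d i j) ≈ M.diagonal (φ ∘ d) i j
  diagonal-homo d i j with does (i ≟ j)
  ... | true  = refl
  ... | false = 0#-homo

  det-homo : (A : R.Matrix n) → φ (R.det A) ≈ M.det (λ i j → φ (A i j))
  det-homo {zero}  A = 1#-homo
  det-homo {suc n} A = trans
    (sum-homo (λ j → (R.- R.1#) R.^ toℕ j R.* (A zero j R.* R.det (λ i k → A (suc i) (punchIn j k)))))
    (sum-cong λ j → trans (*-homo _ _) (*-cong (sign-homo j)
      (trans (*-homo _ _) (*-congˡ {φ (A zero j)} (det-homo (λ i k → A (suc i) (punchIn j k)))))))
    where
    sign-homo : ∀ {n} (j : Fin n) → φ ((R.- R.1#) R.^ toℕ j) ≈ (- 1#) M.^ toℕ j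
    sign-homo zero    = 1#-homo
    sign-homo (suc j) = trans (*-homo _ _) (*-cong (trans (-‿homo _) (-‿cong 1#-homo)) (sign-homo j))

  laplacian-homo : (G : Graph n) → ∀ i j → φ (R.laplacian G i j) ≈ M.laplacian G i j
  laplacian-homo G i j = trans (sub-homo _ _) (+-cong
    (trans (diagonal-homo (λ i → R.nat (Graph.degree G i)) i j)
           (Determinants.diagonal-cong S (λ i → nat-homo (Graph.degree G i)) i j))
    (-‿cong (adjacency-homo (does (Graph.E? G i j)))))
    where
    adjacency-homo : ∀ e → φ (if e then R.1# else R.0#) ≈ (if e then 1# else 0#)
    adjacency-homo true  = 1#-homo
    adjacency-homo false = 0#-homo

  f-laplacian-homo : (G : Graph n) → ∀ t → φ (R.f (R.laplacian G) t) ≈ M.f (M.laplacian G) (φ t)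
  f-laplacian-homo G t = trans (det-homo (R.scalar t R.-ᴹ R.laplacian G)) (det-cong λ i j →
    trans (sub-homo _ _) (+-cong (diagonal-homo (λ _ → t) i j) (-‿cong (laplacian-homo G i j))))

fieldRing : HeytingField c ℓ₁ ℓ₂ → CommutativeRing c ℓ₁
fieldRing K = HeytingCommutativeRing.commutativeRing (HeytingField.heytingCommutativeRing K)

open import Data.List.Base as List using (List; []; _∷_)

-- The commutative ring K[X]

module PolynomialRing (K : HeytingField c ℓ₁ ℓ₂) where
  open RationalFunctions K
  private
    module K = CommutativeRing (fieldRing K)

  open import Algebra.Properties.Ring K.ring using (-0#≈0#)

  scale : K.Carrier → Poly → Poly
  scale x = List.map (x K.*_)

  coeff-+ : ∀ p q k → coeff (p +ᴾ q) k K.≈ coeff p k K.+ coeff q k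
  coeff-+ []      q       k       = K.sym (K.+-identityˡ _)
  coeff-+ (x ∷ p) []      k       = K.sym (K.+-identityʳ _)
  coeff-+ (x ∷ p) (y ∷ q) zero    = K.refl
  coeff-+ (x ∷ p) (y ∷ q) (suc k) = coeff-+ p q k

  coeff-neg : ∀ p k → coeff (-ᴾ p) k K.≈ K.- coeff p k
  coeff-neg []      k       = K.sym -0#≈0#
  coeff-neg (x ∷ p) zero    = K.refl
  coeff-neg (x ∷ p) (suc k) = coeff-neg p k

  coeff-scale : ∀ x p k → coeff (scale x p) k K.≈ x K.* coeff p k
  coeff-scale x []      k       = K.sym (K.zeroʳ x)
  coeff-scale x (y ∷ p) zero    = K.refl
  coeff-scale x (y ∷ p) (suc k) = coeff-scale x p k

  ≈ᴾ-refl : ∀ {p} → p ≈ᴾ p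
  ≈ᴾ-refl = coeffwise λ k → K.refl

  ≈ᴾ-sym : ∀ {p q} → p ≈ᴾ q → q ≈ᴾ p
  ≈ᴾ-sym p≈q = coeffwise λ k → K.sym (coeff≈ p≈q k)

  ≈ᴾ-trans : ∀ {p q r} → p ≈ᴾ q → q ≈ᴾ r → p ≈ᴾ r
  ≈ᴾ-trans p≈q q≈r = coeffwise λ k → K.trans (coeff≈ p≈q k) (coeff≈ q≈r k)

  ∷-cong : ∀ {x y p q} → x K.≈ y → p ≈ᴾ q → x ∷ p ≈ᴾ y ∷ q
  ∷-cong x≈y p≈q = coeffwise λ { zero → x≈y ; (suc k) → coeff≈ p≈q k }

  ∷≈[] : ∀ {x p} → x K.≈ K.0# → p ≈ᴾ [] → x ∷ p ≈ᴾ []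
  ∷≈[] x≈0 p≈[] = coeffwise λ { zero → x≈0 ; (suc k) → coeff≈ p≈[] k }

  +ᴾ-cong : ∀ {p q r s} → p ≈ᴾ q → r ≈ᴾ s → p +ᴾ r ≈ᴾ q +ᴾ s
  +ᴾ-cong {p} {q} {r} {s} p≈q r≈s = coeffwise λ k → K.trans (coeff-+ p r k)
    (K.trans (K.+-cong (coeff≈ p≈q k) (coeff≈ r≈s k)) (K.sym (coeff-+ q s k)))

  +ᴾ-assoc : ∀ p q r → (p +ᴾ q) +ᴾ r ≈ᴾ p +ᴾ (q +ᴾ r)
  +ᴾ-assoc []      q       r       = ≈ᴾ-refl
  +ᴾ-assoc (x ∷ p) []      r       = ≈ᴾ-refl
  +ᴾ-assoc (x ∷ p) (y ∷ q) []      = ≈ᴾ-refl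
  +ᴾ-assoc (x ∷ p) (y ∷ q) (z ∷ r) = ∷-cong (K.+-assoc x y z) (+ᴾ-assoc p q r)

  +ᴾ-comm : ∀ p q → p +ᴾ q ≈ᴾ q +ᴾ p
  +ᴾ-comm []      []      = ≈ᴾ-refl
  +ᴾ-comm []      (y ∷ q) = ≈ᴾ-refl
  +ᴾ-comm (x ∷ p) []      = ≈ᴾ-refl
  +ᴾ-comm (x ∷ p) (y ∷ q) = ∷-cong (K.+-comm x y) (+ᴾ-comm p q)

  -ᴾ-cong : ∀ {p q} → p ≈ᴾ q → -ᴾ p ≈ᴾ -ᴾ q
  -ᴾ-cong {p} {q} p≈q = coeffwise λ k →
    K.trans (coeff-neg p k) (K.trans (K.-‿cong (coeff≈ p≈q k)) (K.sym (coeff-neg q k)))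

  -ᴾ-inverseˡ : ∀ p → (-ᴾ p) +ᴾ p ≈ᴾ []
  -ᴾ-inverseˡ []      = ≈ᴾ-refl
  -ᴾ-inverseˡ (x ∷ p) = ∷≈[] (K.-‿inverseˡ x) (-ᴾ-inverseˡ p)

  +ᴾ-isAbelianGroup : IsAbelianGroup _≈ᴾ_ _+ᴾ_ [] -ᴾ_
  +ᴾ-isAbelianGroup = record
    { isGroup = record
      { isMonoid = record
        { isSemigroup = record
          { isMagma = record
            { isEquivalence = record { refl = ≈ᴾ-refl ; sym = ≈ᴾ-sym ; trans = ≈ᴾ-trans }
            ; ∙-cong = +ᴾ-cong
            }
          ; assoc = +ᴾ-assoc
          }
        ; identity = (λ p → ≈ᴾ-refl) , λ p → +ᴾ-comm p []
        }
      ; inverse = -ᴾ-inverseˡ , λ p → ≈ᴾ-trans (+ᴾ-comm p (-ᴾ p)) (-ᴾ-inverseˡ p)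
      ; ⁻¹-cong = -ᴾ-cong
      }
    ; comm = +ᴾ-comm
    }

  private
    +ᴾ-abelianGroup : AbelianGroup _ _
    +ᴾ-abelianGroup = record { isAbelianGroup = +ᴾ-isAbelianGroup }
    module +ᴾ = AbelianGroup +ᴾ-abelianGroup

  open import Algebra.Properties.CommutativeSemigroup
    (CommutativeMonoid.commutativeSemigroup +ᴾ.commutativeMonoid) as +ᴾ′ using ()
  open import Relation.Binary.Reasoning.Setoid +ᴾ.setoid

  scale-cong : ∀ {x y p q} → x K.≈ y → p ≈ᴾ q → scale x p ≈ᴾ scale y q
  scale-cong {x} {y} {p} {q} x≈y p≈q = coeffwise λ k → K.trans (coeff-scale x p k)
    (K.trans (K.*-cong x≈y (coeff≈ p≈q k)) (K.sym (coeff-scale y q k)))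

  scale-+ : ∀ x p q → scale x (p +ᴾ q) ≈ᴾ scale x p +ᴾ scale x q
  scale-+ x []      q       = ≈ᴾ-refl
  scale-+ x (y ∷ p) []      = ≈ᴾ-refl
  scale-+ x (y ∷ p) (z ∷ q) = ∷-cong (K.distribˡ x y z) (scale-+ x p q)

  +-scale : ∀ x y p → scale (x K.+ y) p ≈ᴾ scale x p +ᴾ scale y p
  +-scale x y []      = ≈ᴾ-refl
  +-scale x y (z ∷ p) = ∷-cong (K.distribʳ z x y) (+-scale x y p)

  scale-scale : ∀ x y p → scale x (scale y p) ≈ᴾ scale (x K.* y) p
  scale-scale x y []      = ≈ᴾ-refl
  scale-scale x y (z ∷ p) = ∷-cong (K.sym (K.*-assoc x y z)) (scale-scale x y p)

  0-scale : ∀ p → scale K.0# p ≈ᴾ []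
  0-scale []      = ≈ᴾ-refl
  0-scale (x ∷ p) = ∷≈[] (K.zeroˡ x) (0-scale p)

  1-scale : ∀ p → scale K.1# p ≈ᴾ p
  1-scale []      = ≈ᴾ-refl
  1-scale (x ∷ p) = ∷-cong (K.*-identityˡ x) (1-scale p)

  0∷-+ : ∀ p q → K.0# ∷ p +ᴾ q ≈ᴾ (K.0# ∷ p) +ᴾ (K.0# ∷ q)
  0∷-+ p q = ∷-cong (K.sym (K.+-identityˡ K.0#)) ≈ᴾ-refl

  scale-* : ∀ x p q → scale x (p *ᴾ q) ≈ᴾ scale x p *ᴾ q
  scale-* x []      q = ≈ᴾ-refl
  scale-* x (y ∷ p) q = ≈ᴾ-trans (scale-+ x (scale y q) (K.0# ∷ p *ᴾ q))
    (+ᴾ-cong (scale-scale x y q) (∷-cong (K.zeroʳ x) (scale-* x p q)))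

  *ᴾ-congˡ : ∀ p {q r} → q ≈ᴾ r → p *ᴾ q ≈ᴾ p *ᴾ r
  *ᴾ-congˡ []      q≈r = ≈ᴾ-refl
  *ᴾ-congˡ (x ∷ p) q≈r = +ᴾ-cong (scale-cong K.refl q≈r) (∷-cong K.refl (*ᴾ-congˡ p q≈r))

  *ᴾ-zeroʳ : ∀ p → p *ᴾ [] ≈ᴾ []
  *ᴾ-zeroʳ []      = ≈ᴾ-refl
  *ᴾ-zeroʳ (x ∷ p) = ∷≈[] K.refl (*ᴾ-zeroʳ p)

  -- Multiplication recurses on the left factor; this is the matching recursion on the right factor,
  -- and the two together give commutativity.
  *ᴾ-∷ : ∀ p y q → p *ᴾ (y ∷ q) ≈ᴾ scale y p +ᴾ (K.0# ∷ p *ᴾ q)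
  *ᴾ-∷ []      y q = ≈ᴾ-sym (∷≈[] K.refl ≈ᴾ-refl)
  *ᴾ-∷ (x ∷ p) y q = ∷-cong (K.+-congʳ (K.*-comm x y)) (begin
    scale x q +ᴾ p *ᴾ (y ∷ q)                        ≈⟨ +ᴾ-cong ≈ᴾ-refl (*ᴾ-∷ p y q) ⟩
    scale x q +ᴾ (scale y p +ᴾ (K.0# ∷ p *ᴾ q))      ≈⟨ +ᴾ′.x∙yz≈y∙xz (scale x q) (scale y p) _ ⟩
    scale y p +ᴾ (scale x q +ᴾ (K.0# ∷ p *ᴾ q))      ∎)

  *ᴾ-comm : ∀ p q → p *ᴾ q ≈ᴾ q *ᴾ p
  *ᴾ-comm []      q = ≈ᴾ-sym (*ᴾ-zeroʳ q)
  *ᴾ-comm (x ∷ p) q = ≈ᴾ-trans (+ᴾ-cong ≈ᴾ-refl (∷-cong K.refl (*ᴾ-comm p q))) (≈ᴾ-sym (*ᴾ-∷ q x p))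

  -- Equal polynomials may be lists of different lengths, which makes induction on the left factors
  -- awkward. Commutativity moves them to the right, where `*ᴾ-congˡ` applies.
  *ᴾ-cong : ∀ {p q r s} → p ≈ᴾ q → r ≈ᴾ s → p *ᴾ r ≈ᴾ q *ᴾ s
  *ᴾ-cong {p} {q} {r} {s} p≈q r≈s = begin
    p *ᴾ r  ≈⟨ *ᴾ-congˡ p r≈s ⟩
    p *ᴾ s  ≈⟨ *ᴾ-comm p s ⟩
    s *ᴾ p  ≈⟨ *ᴾ-congˡ s p≈q ⟩
    s *ᴾ q  ≈⟨ *ᴾ-comm s q ⟩
    q *ᴾ s  ∎

  *ᴾ-distribʳ : ∀ r p q → (p +ᴾ q) *ᴾ r ≈ᴾ p *ᴾ r +ᴾ q *ᴾ r
  *ᴾ-distribʳ r []      q       = ≈ᴾ-refl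
  *ᴾ-distribʳ r (x ∷ p) []      = +ᴾ-comm [] _
  *ᴾ-distribʳ r (x ∷ p) (y ∷ q) = begin
    scale (x K.+ y) r +ᴾ (K.0# ∷ (p +ᴾ q) *ᴾ r)
      ≈⟨ +ᴾ-cong (+-scale x y r) (≈ᴾ-trans (∷-cong K.refl (*ᴾ-distribʳ r p q)) (0∷-+ (p *ᴾ r) (q *ᴾ r))) ⟩
    (scale x r +ᴾ scale y r) +ᴾ ((K.0# ∷ p *ᴾ r) +ᴾ (K.0# ∷ q *ᴾ r))
      ≈⟨ +ᴾ′.interchange (scale x r) (scale y r) _ _ ⟩
    (x ∷ p) *ᴾ r +ᴾ (y ∷ q) *ᴾ r
      ∎

  0∷-* : ∀ p q → (K.0# ∷ p) *ᴾ q ≈ᴾ K.0# ∷ p *ᴾ q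
  0∷-* p q = +ᴾ-cong (0-scale q) ≈ᴾ-refl

  *ᴾ-assoc : ∀ p q r → (p *ᴾ q) *ᴾ r ≈ᴾ p *ᴾ (q *ᴾ r)
  *ᴾ-assoc []      q r = ≈ᴾ-refl
  *ᴾ-assoc (x ∷ p) q r = begin
    (scale x q +ᴾ (K.0# ∷ p *ᴾ q)) *ᴾ r
      ≈⟨ *ᴾ-distribʳ r (scale x q) (K.0# ∷ p *ᴾ q) ⟩
    scale x q *ᴾ r +ᴾ (K.0# ∷ p *ᴾ q) *ᴾ r
      ≈⟨ +ᴾ-cong (≈ᴾ-sym (scale-* x q r)) (≈ᴾ-trans (0∷-* (p *ᴾ q) r) (∷-cong K.refl (*ᴾ-assoc p q r))) ⟩
    (x ∷ p) *ᴾ (q *ᴾ r)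
      ∎

  *ᴾ-identityˡ : ∀ p → constᴾ K.1# *ᴾ p ≈ᴾ p
  *ᴾ-identityˡ p = ≈ᴾ-trans (+ᴾ-cong (1-scale p) (∷≈[] K.refl (≈ᴾ-refl {[]}))) (+ᴾ-comm p [])

  polyRing : CommutativeRing _ _
  polyRing = record
    { isCommutativeRing = record
      { isRing = record
        { +-isAbelianGroup = +ᴾ-isAbelianGroup
        ; *-cong           = *ᴾ-cong
        ; *-assoc          = *ᴾ-assoc
        ; *-identity       = Consequences.comm∧idˡ⇒id +ᴾ.setoid *ᴾ-comm {e = constᴾ K.1#} *ᴾ-identityˡ
        ; distrib          = Consequences.comm∧distrʳ⇒distrˡ +ᴾ.setoid +ᴾ-cong *ᴾ-comm *ᴾ-distribʳ , *ᴾ-distribʳ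
        }
      ; *-comm = *ᴾ-comm
      }
    }

  constᴾ-isHomomorphism : IsRingHomomorphism K.rawRing K[X] constᴾ
  constᴾ-isHomomorphism = isRingHomomorphism (λ x≈y → ∷-cong x≈y ≈ᴾ-refl) (λ x y → ≈ᴾ-refl)
    (∷≈[] K.refl (≈ᴾ-refl {[]})) (λ x y → ∷-cong (K.sym (K.+-identityʳ _)) ≈ᴾ-refl) ≈ᴾ-refl (λ x → ≈ᴾ-refl)

-- The equations of the field of fractions of R, multiplied out for the fractions u / v, w / x, y / z.
module CrossMultiplication (R : CommutativeRing c ℓ) where
  open CommutativeRing R hiding (zero)
  open import Algebra.Properties.Ring ring using (-‿distribˡ-*)
  open import Algebra.Solver.Ring.NaturalCoefficients.Default commutativeSemiring
    using (solve; _:+_; _:*_; _:=_; con)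
  open import Relation.Binary.Reasoning.Setoid setoid

  ≈-trans : ∀ {u v w x y z} → u * x ≈ w * v → w * z ≈ y * x → u * z * x ≈ y * v * x
  ≈-trans {u} {v} {w} {x} {y} {z} ux≈wv wz≈yx = begin
    u * z * x    ≈⟨ swapʳ u z x ⟩
    u * x * z    ≈⟨ *-congʳ ux≈wv ⟩
    w * v * z    ≈⟨ swapʳ w v z ⟩
    w * z * v    ≈⟨ *-congʳ wz≈yx ⟩
    y * x * v    ≈⟨ swapʳ y x v ⟩
    y * v * x    ∎
    where
    swapʳ : ∀ x y z → x * y * z ≈ x * z * y
    swapʳ = solve 3 (λ x y z → x :* y :* z := x :* z :* y) refl

  *-cross : ∀ {u u′ v v′ w w′ x x′} → u * v′ ≈ u′ * v → w * x′ ≈ w′ * x →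
    u * w * (v′ * x′) ≈ u′ * w′ * (v * x)
  *-cross {u} {u′} {v} {v′} {w} {w′} {x} {x′} uv′ wx′ = begin
    u * w * (v′ * x′)     ≈⟨ interchange u w v′ x′ ⟩
    (u * v′) * (w * x′)   ≈⟨ *-cong uv′ wx′ ⟩
    (u′ * v) * (w′ * x)   ≈⟨ interchange u′ v w′ x ⟩
    u′ * w′ * (v * x)     ∎
    where
    interchange : ∀ w x y z → (w * x) * (y * z) ≈ (w * y) * (x * z)
    interchange = solve 4 (λ w x y z → (w :* x) :* (y :* z) := (w :* y) :* (x :* z)) refl

  +-cross : ∀ {u u′ v v′ w w′ x x′} → u * v′ ≈ u′ * v → w * x′ ≈ w′ * x →
    (u * x + w * v) * (v′ * x′) ≈ (u′ * x′ + w′ * v′) * (v * x)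
  +-cross {u} {u′} {v} {v′} {w} {w′} {x} {x′} uv′ wx′ = begin
    (u * x + w * v) * (v′ * x′)
      ≈⟨ solve 6 (λ u v v′ w x x′ → (u :* x :+ w :* v) :* (v′ :* x′) :=
           (u :* v′) :* (x :* x′) :+ (w :* x′) :* (v :* v′)) refl u v v′ w x x′ ⟩
    (u * v′) * (x * x′) + (w * x′) * (v * v′)
      ≈⟨ +-cong (*-congʳ uv′) (*-congʳ wx′) ⟩
    (u′ * v) * (x * x′) + (w′ * x) * (v * v′)
      ≈⟨ solve 6 (λ u′ v v′ w′ x x′ → (u′ :* v) :* (x :* x′) :+ (w′ :* x) :* (v :* v′) :=
           (u′ :* x′ :+ w′ :* v′) :* (v :* x)) refl u′ v v′ w′ x x′ ⟩
    (u′ * x′ + w′ * v′) * (v * x)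
      ∎

  +-assoc-cross : ∀ u v w x y z →
    ((u * x + w * v) * z + y * (v * x)) * (v * (x * z)) ≈
    (u * (x * z) + (w * z + y * x) * v) * ((v * x) * z)
  +-assoc-cross = solve 6 (λ u v w x y z →
    ((u :* x :+ w :* v) :* z :+ y :* (v :* x)) :* (v :* (x :* z)) :=
    (u :* (x :* z) :+ (w :* z :+ y :* x) :* v) :* ((v :* x) :* z)) refl

  +-comm-cross : ∀ u v w x → (u * x + w * v) * (x * v) ≈ (w * v + u * x) * (v * x)
  +-comm-cross = solve 4 (λ u v w x →
    (u :* x :+ w :* v) :* (x :* v) := (w :* v :+ u :* x) :* (v :* x)) refl

  +-identityˡ-cross : ∀ u v → (0# * v + u * 1#) * v ≈ u * (1# * v)
  +-identityˡ-cross = solve 2 (λ u v → (con 0 :* v :+ u :* con 1) :* v := u :* (con 1 :* v)) refl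

  -‿cross : ∀ {u v w x} → u * x ≈ w * v → - u * x ≈ - w * v
  -‿cross ux≈wv = trans (sym (-‿distribˡ-* _ _)) (trans (-‿cong ux≈wv) (-‿distribˡ-* _ _))

  inverseˡ-cross : ∀ u v → (- u * v + u * v) * 1# ≈ 0# * (v * v)
  inverseˡ-cross u v = begin
    (- u * v + u * v) * 1#  ≈⟨ *-identityʳ _ ⟩
    - u * v + u * v         ≈⟨ distribʳ _ _ _ ⟨
    (- u + u) * v           ≈⟨ *-congʳ (-‿inverseˡ u) ⟩
    0# * v                  ≈⟨ trans (zeroˡ v) (sym (zeroˡ _)) ⟩
    0# * (v * v)            ∎

  *-assoc-cross : ∀ u v w x y z → (u * w * y) * (v * (x * z)) ≈ (u * (w * y)) * (v * x * z)
  *-assoc-cross = solve 6 (λ u v w x y z →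
    (u :* w :* y) :* (v :* (x :* z)) := (u :* (w :* y)) :* (v :* x :* z)) refl

  *-comm-cross : ∀ u v w x → (u * w) * (x * v) ≈ (w * u) * (v * x)
  *-comm-cross = solve 4 (λ u v w x → (u :* w) :* (x :* v) := (w :* u) :* (v :* x)) refl

  *-identityˡ-cross : ∀ u v → (1# * u) * v ≈ u * (1# * v)
  *-identityˡ-cross = solve 2 (λ u v → (con 1 :* u) :* v := u :* (con 1 :* v)) refl

  distribʳ-cross : ∀ u v w x y z →
    ((w * z + y * x) * u) * ((x * v) * (z * v)) ≈ ((w * u) * (z * v) + (y * u) * (x * v)) * ((x * z) * v)
  distribʳ-cross = solve 6 (λ u v w x y z →
    ((w :* z :+ y :* x) :* u) :* ((x :* v) :* (z :* v)) :=
    ((w :* u) :* (z :* v) :+ (y :* u) :* (x :* v)) :* ((x :* z) :* v)) refl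

  +-1-cross : ∀ u v → (u + v) * (1# * 1#) ≈ (u * 1# + v * 1#) * 1#
  +-1-cross = solve 2 (λ u v → (u :+ v) :* (con 1 :* con 1) := (u :* con 1 :+ v :* con 1) :* con 1) refl

  *-1-cross : ∀ u v → (u * v) * (1# * 1#) ≈ (u * v) * 1#
  *-1-cross = solve 2 (λ u v → (u :* v) :* (con 1 :* con 1) := (u :* v) :* con 1) refl

  *-reciprocal-cross : ∀ u → (u * 1#) * 1# ≈ 1# * (1# * u)
  *-reciprocal-cross = solve 1 (λ u → (u :* con 1) :* con 1 := con 1 :* (con 1 :* u)) refl

-- The field of fractions K(X)

module FractionField (K : HeytingField c ℓ₁ ℓ₂) where
  open RationalFunctions K
  open PolynomialRing K using (polyRing)
  private
    module P = CommutativeRing polyRing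
    module F = RawRing K⟨X⟩
  open CrossMultiplication polyRing
  open import Algebra.Properties.Ring P.ring using ([y-z]x≈yx-zx; x∙y⁻¹≈ε⇒x≈y; x≈y⇒x∙y⁻¹≈ε)

  *ᴾ-cancel : ∀ p q r → r ≉ᴾ [] → p *ᴾ r ≈ᴾ q *ᴾ r → p ≈ᴾ q
  *ᴾ-cancel p q r r≉0 pr≈qr = x∙y⁻¹≈ε⇒x≈y p q
    (*ᴾ-cancelʳ (p P.- q) r r≉0 (P.trans ([y-z]x≈yx-zx r p q) (x≈y⇒x∙y⁻¹≈ε pr≈qr)))

  ≈ᶠ-refl : ∀ {u} → u ≈ᶠ u
  ≈ᶠ-refl = cross P.refl

  ≈ᶠ-sym : ∀ {u v} → u ≈ᶠ v → v ≈ᶠ u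
  ≈ᶠ-sym u≈v = cross (P.sym (cross≈ u≈v))

  -- Combining the two cross products yields the desired equation only up to the denominator of the
  -- middle fraction, which is cancelled because it is not zero.
  ≈ᶠ-trans : ∀ {u v w} → u ≈ᶠ v → v ≈ᶠ w → u ≈ᶠ w
  ≈ᶠ-trans {u} {v} {w} u≈v v≈w = cross
    (*ᴾ-cancel (num u *ᴾ den w) (num w *ᴾ den u) (den v) (den≉0 v)
      (≈-trans {num u} {den u} {num v} {den v} {num w} {den w} (cross≈ u≈v) (cross≈ v≈w)))

  ≈ᶠ-isEquivalence : IsEquivalence _≈ᶠ_
  ≈ᶠ-isEquivalence = record
    { refl  = λ {u} → ≈ᶠ-refl {u}
    ; sym   = λ {u} {v} → ≈ᶠ-sym {u} {v}
    ; trans = λ {u} {v} {w} → ≈ᶠ-trans {u} {v} {w}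
    }

  +ᶠ-cong : Congruent₂ _≈ᶠ_ F._+_
  +ᶠ-cong {u} {u′} {v} {v′} u≈u′ v≈v′ = cross (+-cross
    {num u} {num u′} {den u} {den u′} {num v} {num v′} {den v} {den v′} (cross≈ u≈u′) (cross≈ v≈v′))

  *ᶠ-cong : Congruent₂ _≈ᶠ_ F._*_
  *ᶠ-cong {u} {u′} {v} {v′} u≈u′ v≈v′ = cross (*-cross
    {num u} {num u′} {den u} {den u′} {num v} {num v′} {den v} {den v′} (cross≈ u≈u′) (cross≈ v≈v′))

  +ᶠ-comm : Commutative _≈ᶠ_ F._+_
  +ᶠ-comm u v = cross (+-comm-cross (num u) (den u) (num v) (den v))

  *ᶠ-comm : Commutative _≈ᶠ_ F._*_
  *ᶠ-comm u v = cross (*-comm-cross (num u) (den u) (num v) (den v))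

  *ᶠ-distribʳ : _DistributesOverʳ_ _≈ᶠ_ F._*_ F._+_
  *ᶠ-distribʳ u v w = cross (distribʳ-cross (num u) (den u) (num v) (den v) (num w) (den w))

  +ᶠ-assoc : Associative _≈ᶠ_ F._+_
  +ᶠ-assoc u v w = cross (+-assoc-cross (num u) (den u) (num v) (den v) (num w) (den w))

  *ᶠ-assoc : Associative _≈ᶠ_ F._*_
  *ᶠ-assoc u v w = cross (*-assoc-cross (num u) (den u) (num v) (den v) (num w) (den w))

  +ᶠ-identityˡ : LeftIdentity _≈ᶠ_ F.0# F._+_
  +ᶠ-identityˡ u = cross (+-identityˡ-cross (num u) (den u))

  *ᶠ-identityˡ : LeftIdentity _≈ᶠ_ F.1# F._*_
  *ᶠ-identityˡ u = cross (*-identityˡ-cross (num u) (den u))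

  -ᶠ-inverseˡ : LeftInverse _≈ᶠ_ F.0# F.-_ F._+_
  -ᶠ-inverseˡ u = cross (inverseˡ-cross (num u) (den u))

  -ᶠ-cong : Congruent₁ _≈ᶠ_ F.-_
  -ᶠ-cong {u} {v} u≈v = cross (-‿cross {num u} {den u} {num v} {den v} (cross≈ u≈v))

  +ᶠ-identity : Identity _≈ᶠ_ F.0# F._+_
  +ᶠ-identity = +ᶠ-identityˡ , λ u → ≈ᶠ-trans {u F.+ F.0#} {F.0# F.+ u} {u} (+ᶠ-comm u F.0#) (+ᶠ-identityˡ u)

  *ᶠ-identity : Identity _≈ᶠ_ F.1# F._*_
  *ᶠ-identity = *ᶠ-identityˡ , λ u → ≈ᶠ-trans {u F.* F.1#} {F.1# F.* u} {u} (*ᶠ-comm u F.1#) (*ᶠ-identityˡ u)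

  -ᶠ-inverse : Inverse _≈ᶠ_ F.0# F.-_ F._+_
  -ᶠ-inverse = -ᶠ-inverseˡ , λ u → ≈ᶠ-trans {u F.+ (F.- u)} {(F.- u) F.+ u} {F.0#} (+ᶠ-comm u (F.- u)) (-ᶠ-inverseˡ u)

  *ᶠ-distribˡ : _DistributesOverˡ_ _≈ᶠ_ F._*_ F._+_
  *ᶠ-distribˡ u v w =
    ≈ᶠ-trans {u F.* (v F.+ w)} {(v F.+ w) F.* u} {u F.* v F.+ u F.* w} (*ᶠ-comm u (v F.+ w))
    (≈ᶠ-trans {(v F.+ w) F.* u} {v F.* u F.+ w F.* u} {u F.* v F.+ u F.* w} (*ᶠ-distribʳ u v w)
    (+ᶠ-cong {v F.* u} {u F.* v} {w F.* u} {u F.* w} (*ᶠ-comm v u) (*ᶠ-comm w u)))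

  +ᶠ-isAbelianGroup : IsAbelianGroup _≈ᶠ_ F._+_ F.0# F.-_
  +ᶠ-isAbelianGroup = record
    { isGroup = record
      { isMonoid = record
        { isSemigroup = record
          { isMagma = record { isEquivalence = ≈ᶠ-isEquivalence ; ∙-cong = λ {u} {v} {w} {z} → +ᶠ-cong {u} {v} {w} {z} }
          ; assoc = +ᶠ-assoc
          }
        ; identity = +ᶠ-identity
        }
      ; inverse = -ᶠ-inverse
      ; ⁻¹-cong = λ {u} {v} → -ᶠ-cong {u} {v}
      }
    ; comm = +ᶠ-comm
    }

  fractionRing : CommutativeRing (c ⊔ ℓ₁) ℓ₁
  fractionRing = record
    { Carrier = Fraction ; _≈_ = _≈ᶠ_ ; _+_ = F._+_ ; _*_ = F._*_ ; -_ = F.-_ ; 0# = F.0# ; 1# = F.1#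
    ; isCommutativeRing = record
      { isRing = record
        { +-isAbelianGroup = +ᶠ-isAbelianGroup
        ; *-cong           = λ {u} {v} {w} {z} → *ᶠ-cong {u} {v} {w} {z}
        ; *-assoc          = *ᶠ-assoc
        ; *-identity       = *ᶠ-identity
        ; distrib          = *ᶠ-distribˡ , *ᶠ-distribʳ
        }
      ; *-comm = *ᶠ-comm
      }
    }

  fromPoly-isHomomorphism : IsRingHomomorphism K[X] K⟨X⟩ fromPoly
  fromPoly-isHomomorphism = isRingHomomorphism
    (λ p≈q → cross (P.*-congʳ p≈q)) (λ p q → cross (+-1-cross p q)) ≈ᶠ-refl
    (λ p q → cross (*-1-cross p q)) ≈ᶠ-refl (λ p → ≈ᶠ-refl)

  reciprocal : ∀ p → p ≉ᴾ [] → Fraction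
  reciprocal p p≉0 = constᴾ (HeytingField.1# K) / p [ p≉0 ]

  *-reciprocal : ∀ p (p≉0 : p ≉ᴾ []) → fromPoly p F.* reciprocal p p≉0 ≈ᶠ F.1#
  *-reciprocal p p≉0 = cross (*-reciprocal-cross p)

  const-isHomomorphism : IsRingHomomorphism (CommutativeRing.rawRing (fieldRing K)) K⟨X⟩ const
  const-isHomomorphism = Composition.isRingHomomorphism (λ {u} {v} {w} → ≈ᶠ-trans {u} {v} {w})
    (PolynomialRing.constᴾ-isHomomorphism K) fromPoly-isHomomorphism

-- Evaluation of polynomials in a K-algebra

module Evaluation (K : HeytingField c ℓ₁ ℓ₂) (S : CommutativeRing c′ ℓ′)
  (φ : HeytingField.Carrier K → CommutativeRing.Carrier S)
  (isHomomorphism : IsRingHomomorphism (CommutativeRing.rawRing (fieldRing K)) (CommutativeRing.rawRing S) φ)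
  (z : CommutativeRing.Carrier S) where
  private
    module K = CommutativeRing (fieldRing K)
    module φ = IsRingHomomorphism isHomomorphism
  open RationalFunctions K
  open PolynomialRing K using (scale)
  open CommutativeRing S hiding (zero)
  open import Algebra.Properties.Ring ring using (-‿distribʳ-*; -‿+-comm; -0#≈0#)
  open import Algebra.Properties.CommutativeSemigroup +-commutativeSemigroup using (interchange)
  open import Algebra.Properties.CommutativeSemigroup *-commutativeSemigroup using (x∙yz≈y∙xz)
  open import Relation.Binary.Reasoning.Setoid setoid

  eval : Poly → Carrier
  eval []      = 0#
  eval (x ∷ p) = φ x + z * eval p

  eval-≈0 : ∀ {x p} → x K.≈ K.0# → eval p ≈ 0# → eval (x ∷ p) ≈ 0#
  eval-≈0 {x} {p} x≈0 p≈0 = begin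
    φ x + z * eval p  ≈⟨ +-cong (trans (φ.⟦⟧-cong x≈0) φ.0#-homo) (*-congˡ p≈0) ⟩
    0# + z * 0#       ≈⟨ trans (+-identityˡ _) (zeroʳ z) ⟩
    0#                ∎

  -- Where the lists differ in length, the surplus coefficients are zero, and so is their
  -- contribution.
  eval-cong : ∀ {p q} → p ≈ᴾ q → eval p ≈ eval q
  eval-cong {[]}    {[]}    p≈q = refl
  eval-cong {[]}    {y ∷ q} p≈q = sym (eval-≈0 {y} {q} (K.sym (coeff≈ p≈q zero))
    (sym (eval-cong {[]} {q} (coeffwise λ k → coeff≈ p≈q (suc k)))))
  eval-cong {x ∷ p} {[]}    p≈q = eval-≈0 {x} {p} (coeff≈ p≈q zero)
    (eval-cong {p} {[]} (coeffwise λ k → coeff≈ p≈q (suc k)))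
  eval-cong {x ∷ p} {y ∷ q} p≈q = +-cong (φ.⟦⟧-cong (coeff≈ p≈q zero))
    (*-congˡ (eval-cong {p} {q} (coeffwise λ k → coeff≈ p≈q (suc k))))

  eval-+ : ∀ p q → eval (p +ᴾ q) ≈ eval p + eval q
  eval-+ []      q       = sym (+-identityˡ _)
  eval-+ (x ∷ p) []      = sym (+-identityʳ _)
  eval-+ (x ∷ p) (y ∷ q) = begin
    φ (x K.+ y) + z * eval (p +ᴾ q)             ≈⟨ +-cong (φ.+-homo x y) (trans (*-congˡ (eval-+ p q)) (distribˡ z _ _)) ⟩
    φ x + φ y + (z * eval p + z * eval q)       ≈⟨ interchange _ _ _ _ ⟩
    (φ x + z * eval p) + (φ y + z * eval q)     ∎

  eval-scale : ∀ x p → eval (scale x p) ≈ φ x * eval p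
  eval-scale x []      = sym (zeroʳ _)
  eval-scale x (y ∷ p) = begin
    φ (x K.* y) + z * eval (scale x p)    ≈⟨ +-cong (φ.*-homo x y) (trans (*-congˡ (eval-scale x p)) (x∙yz≈y∙xz _ _ _)) ⟩
    φ x * φ y + φ x * (z * eval p)        ≈⟨ distribˡ _ _ _ ⟨
    φ x * (φ y + z * eval p)              ∎

  eval-* : ∀ p q → eval (p *ᴾ q) ≈ eval p * eval q
  eval-* []      q = sym (zeroˡ _)
  eval-* (x ∷ p) q = begin
    eval (scale x q +ᴾ (K.0# ∷ p *ᴾ q))
      ≈⟨ eval-+ (scale x q) (K.0# ∷ p *ᴾ q) ⟩
    eval (scale x q) + (φ K.0# + z * eval (p *ᴾ q))
      ≈⟨ +-cong (eval-scale x q) (trans (+-congʳ φ.0#-homo) (trans (+-identityˡ _) (*-congˡ (eval-* p q)))) ⟩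
    φ x * eval q + z * (eval p * eval q)
      ≈⟨ +-congˡ (*-assoc _ _ _) ⟨
    φ x * eval q + z * eval p * eval q
      ≈⟨ distribʳ _ _ _ ⟨
    eval (x ∷ p) * eval q
      ∎

  eval-neg : ∀ p → eval (-ᴾ p) ≈ - eval p
  eval-neg []      = sym -0#≈0#
  eval-neg (x ∷ p) = begin
    φ (K.- x) + z * eval (-ᴾ p)  ≈⟨ +-cong (φ.-‿homo x) (trans (*-congˡ (eval-neg p)) (sym (-‿distribʳ-* _ _))) ⟩
    - φ x + - (z * eval p)       ≈⟨ -‿+-comm _ _ ⟩
    - (φ x + z * eval p)         ∎

  eval-constᴾ : ∀ x → eval (constᴾ x) ≈ φ x
  eval-constᴾ x = trans (+-congˡ (zeroʳ z)) (+-identityʳ _)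

  eval-X : eval X ≈ z
  eval-X = begin
    φ K.0# + z * eval (constᴾ K.1#)  ≈⟨ +-cong φ.0#-homo (*-congˡ (trans (eval-constᴾ K.1#) φ.1#-homo)) ⟩
    0# + z * 1#                      ≈⟨ trans (+-identityˡ _) (*-identityʳ z) ⟩
    z                                ∎

  eval-isHomomorphism : IsRingHomomorphism K[X] rawRing eval
  eval-isHomomorphism = isRingHomomorphism (λ {p} {q} → eval-cong {p} {q}) eval-+ refl eval-*
    (trans (eval-constᴾ K.1#) φ.1#-homo) eval-neg

-- Degree bounds and leading coefficients

module Degree (K : HeytingField c ℓ₁ ℓ₂) where
  private
    module K = CommutativeRing (fieldRing K)
    module P = Matrices (RationalFunctions.K[X] K)
    module M = Matrices K.rawRing
  open RationalFunctions K
  open PolynomialRing K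
  open Determinants (fieldRing K) using (sum-cong; sum≈0; x*0≈0; det-cong; det-scalar; 1^)
  open import Algebra.Properties.Ring K.ring using (-0#≈0#)
  open import Relation.Binary.Reasoning.Setoid K.setoid

  -- Degree bounds are stated as vanishing of the higher coefficients: the length of a list does not
  -- give the degree, since trailing zeros need not be recognisable.
  IsConstant : Poly → Set _
  IsConstant p = ∀ k → coeff p (suc k) K.≈ K.0#

  IsLinear : Poly → Set _
  IsLinear p = ∀ k → coeff p (suc (suc k)) K.≈ K.0#

  0+0≈0 : ∀ {x y} → x K.≈ K.0# → y K.≈ K.0# → x K.+ y K.≈ K.0#
  0+0≈0 x≈0 y≈0 = K.trans (K.+-cong x≈0 y≈0) (K.+-identityˡ K.0#)

  -0≈0 : ∀ {x} → x K.≈ K.0# → K.- x K.≈ K.0#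
  -0≈0 x≈0 = K.trans (K.-‿cong x≈0) -0#≈0#

  +-constant : ∀ p q → IsConstant p → IsConstant q → IsConstant (p +ᴾ q)
  +-constant p q p-const q-const k = K.trans (coeff-+ p q (suc k)) (0+0≈0 (p-const k) (q-const k))

  neg-constant : ∀ p → IsConstant p → IsConstant (-ᴾ p)
  neg-constant p p-const k = K.trans (coeff-neg p (suc k)) (-0≈0 (p-const k))

  nat-constant : ∀ m → IsConstant (P.nat m)
  nat-constant zero    k = K.refl
  nat-constant (suc m) k = +-constant (constᴾ K.1#) (P.nat m) (λ _ → K.refl) (nat-constant m) k

  coeff-nat : ∀ m → coeff (P.nat m) zero K.≈ M.nat m
  coeff-nat zero    = K.refl
  coeff-nat (suc m) = K.trans (coeff-+ (constᴾ K.1#) (P.nat m) zero) (K.+-congˡ (coeff-nat m))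

  laplacian-constant : (G : Graph n) → ∀ i j → IsConstant (P.laplacian G i j)
  laplacian-constant G i j = +-constant (P.degrees G i j) (-ᴾ P.adjacency G i j) degrees-constant
    (neg-constant (P.adjacency G i j) adjacency-constant)
    where
    degrees-constant : IsConstant (P.degrees G i j)
    degrees-constant with does (i ≟ j)
    ... | true  = nat-constant (Graph.degree G i)
    ... | false = λ _ → K.refl

    adjacency-constant : IsConstant (P.adjacency G i j)
    adjacency-constant with does (Graph.E? G i j)
    ... | true  = λ _ → K.refl
    ... | false = λ _ → K.refl

  coeff-constant-* : ∀ p q → IsConstant p → ∀ k → coeff (p *ᴾ q) k K.≈ coeff p zero K.* coeff q k
  coeff-constant-* []      q p-const k = K.sym (K.zeroˡ _)
  coeff-constant-* (x ∷ p) q p-const k = begin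
    coeff (scale x q +ᴾ (K.0# ∷ p *ᴾ q)) k
      ≈⟨ coeff-+ (scale x q) _ k ⟩
    coeff (scale x q) k K.+ coeff (K.0# ∷ p *ᴾ q) k
      ≈⟨ K.+-cong (coeff-scale x q k) (coeff≈ (∷≈[] K.refl (*ᴾ-cong {p} {[]} (coeffwise p-const) ≈ᴾ-refl)) k) ⟩
    x K.* coeff q k K.+ K.0#
      ≈⟨ K.+-identityʳ _ ⟩
    x K.* coeff q k
      ∎

  coeff-linear-* : ∀ p q → IsLinear p → ∀ k →
    coeff (p *ᴾ q) (suc k) K.≈ coeff p 0 K.* coeff q (suc k) K.+ coeff p 1 K.* coeff q k
  coeff-linear-* []      q p-linear k = K.sym (0+0≈0 (K.zeroˡ _) (K.zeroˡ _))
  coeff-linear-* (x ∷ p) q p-linear k = K.trans (coeff-+ (scale x q) (K.0# ∷ p *ᴾ q) (suc k))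
    (K.+-cong (coeff-scale x q (suc k)) (coeff-constant-* p q p-linear k))

  coeff-sum : (v : Vector Poly n) → ∀ k → coeff (P.sum v) k K.≈ M.sum (λ i → coeff (v i) k)
  coeff-sum {zero}  v k = K.refl
  coeff-sum {suc n} v k = K.trans (coeff-+ (v zero) (P.sum (tail v)) k) (K.+-congˡ (coeff-sum (tail v) k))

  coeff-sign-* : ∀ j q k → coeff ((P.- P.1#) P.^ j *ᴾ q) k K.≈ (K.- K.1#) M.^ j K.* coeff q k
  coeff-sign-* zero    q k = coeff-constant-* (constᴾ K.1#) q (λ _ → K.refl) k
  coeff-sign-* (suc j) q k = begin
    coeff ((-1ᴾ *ᴾ s) *ᴾ q) k         ≈⟨ coeff≈ (*ᴾ-assoc -1ᴾ s q) k ⟩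
    coeff (-1ᴾ *ᴾ (s *ᴾ q)) k         ≈⟨ coeff-constant-* -1ᴾ (s *ᴾ q) (λ _ → K.refl) k ⟩
    K.- K.1# K.* coeff (s *ᴾ q) k     ≈⟨ K.*-congˡ (coeff-sign-* j q k) ⟩
    K.- K.1# K.* (_ K.* coeff q k)    ≈⟨ K.*-assoc _ _ _ ⟨
    _                                 ∎
    where
    -1ᴾ s : Poly
    -1ᴾ = P.- P.1#
    s = -1ᴾ P.^ j

  -- One expansion step serves both `det-degree` and `det-leading`: multiplication by a linear entry
  -- combines two neighbouring coefficients of the minor.
  coeff-det-linear : (A : P.Matrix (suc n)) → (∀ i j → IsLinear (A i j)) → ∀ k →
    coeff (P.det A) (suc k) K.≈ M.sum λ j → (K.- K.1#) M.^ toℕ j K.*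
      (coeff (A zero j) 0 K.* coeff (P.det λ i l → A (suc i) (punchIn j l)) (suc k)
        K.+ coeff (A zero j) 1 K.* coeff (P.det λ i l → A (suc i) (punchIn j l)) k)
  coeff-det-linear A A-linear k = K.trans
    (coeff-sum (λ j → (P.- P.1#) P.^ toℕ j *ᴾ (A zero j *ᴾ P.det λ i l → A (suc i) (punchIn j l))) (suc k))
    (sum-cong λ j → K.trans
      (coeff-sign-* (toℕ j) (A zero j *ᴾ P.det λ i l → A (suc i) (punchIn j l)) (suc k))
      (K.*-congˡ {(K.- K.1#) M.^ toℕ j}
        (coeff-linear-* (A zero j) (P.det λ i l → A (suc i) (punchIn j l)) (A-linear zero j) k)))

  det-degree : (A : P.Matrix n) → (∀ i j → IsLinear (A i j)) → ∀ k → n ℕ.< k → coeff (P.det A) k K.≈ K.0#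
  det-degree {zero}  A A-linear (suc k) _           = K.refl
  det-degree {suc n} A A-linear (suc k) (ℕ.s≤s n<k) = K.trans (coeff-det-linear A A-linear k)
    (sum≈0 λ j → x*0≈0 ((K.- K.1#) M.^ toℕ j) (0+0≈0
      (x*0≈0 (coeff (A zero j) 0) (minor-degree j (suc k) (ℕ.m<n⇒m<1+n n<k)))
      (x*0≈0 (coeff (A zero j) 1) (minor-degree j k n<k))))
    where
    minor-degree : ∀ j k → n ℕ.< k → coeff (P.det λ i l → A (suc i) (punchIn j l)) k K.≈ K.0#
    minor-degree j = det-degree (λ i l → A (suc i) (punchIn j l)) λ i l → A-linear (suc i) (punchIn j l)

  -- For A = A₀ + X A₁ the top coefficient is det A₁: the constant part of an entry would need a
  -- coefficient of the minor beyond its order, which `det-degree` rules out.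
  det-leading : (A : P.Matrix n) → (∀ i j → IsLinear (A i j)) →
    coeff (P.det A) n K.≈ M.det λ i j → coeff (A i j) 1
  det-leading {zero}  A A-linear = K.refl
  det-leading {suc n} A A-linear = K.trans (coeff-det-linear A A-linear n) (sum-cong λ j →
    K.*-congˡ {(K.- K.1#) M.^ toℕ j} (K.trans
      (K.+-cong (x*0≈0 (coeff (A zero j) 0) (det-degree (minor j) (minor-linear j) (suc n) (ℕ.n<1+n n)))
                (K.*-congˡ {coeff (A zero j) 1} (det-leading (minor j) (minor-linear j))))
      (K.+-identityˡ _)))
    where
    minor : Fin (suc n) → P.Matrix n
    minor j i l = A (suc i) (punchIn j l)

    minor-linear : ∀ j i l → IsLinear (minor j i l)
    minor-linear j i l = A-linear (suc i) (punchIn j l)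

  -- Only the diagonal contains `t`, so the coefficients of X form the identity matrix. A general
  -- monic linear `t` is allowed because the argument in use is X - n₂ rather than X.
  f-monic : (A : P.Matrix n) → (∀ i j → IsConstant (A i j)) → ∀ t → IsLinear t →
    coeff t 1 K.≈ K.1# → coeff (P.f A t) n K.≈ K.1#
  f-monic {n} A A-const t t-linear t-monic = begin
    coeff (P.det (P.scalar t P.-ᴹ A)) n
      ≈⟨ det-leading (P.scalar t P.-ᴹ A) (λ i j k → K.trans (coeff-entry i j (suc k)) (scalar-linear i j k)) ⟩
    M.det (λ i j → coeff (P.scalar t i j P.- A i j) 1)
      ≈⟨ det-cong (λ i j → K.trans (coeff-entry i j zero) (scalar-monic i j)) ⟩
    M.det (M.scalar {n} K.1#)
      ≈⟨ K.trans (det-scalar n K.1#) (1^ n) ⟩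
    K.1#
      ∎
    where
    coeff-entry : ∀ i j k → coeff (P.scalar t i j P.- A i j) (suc k) K.≈ coeff (P.scalar t i j) (suc k)
    coeff-entry i j k = K.trans (coeff-+ (P.scalar t i j) (-ᴾ A i j) (suc k))
      (K.trans (K.+-congˡ (neg-constant (A i j) (A-const i j) k)) (K.+-identityʳ _))

    scalar-linear : ∀ i j → IsLinear (P.scalar t i j)
    scalar-linear i j k with does (i ≟ j)
    ... | true  = t-linear k
    ... | false = K.refl

    scalar-monic : ∀ i j → coeff (P.scalar t i j) 1 K.≈ M.scalar K.1# i j
    scalar-monic i j with does (i ≟ j)
    ... | true  = t-monic
    ... | false = K.refl

  coeff-sub-nat : ∀ p m k → coeff (p P.- P.nat m) (suc k) K.≈ coeff p (suc k)
  coeff-sub-nat p m k = K.trans (coeff-+ p (-ᴾ P.nat m) (suc k))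
    (K.trans (K.+-congˡ (neg-constant (P.nat m) (nat-constant m) k)) (K.+-identityʳ _))

  monic-≉0 : ∀ p k → coeff p k K.≈ K.1# → p ≉ᴾ []
  monic-≉0 p k p≈1 p≈0 = 1≉0 (∷≈[] (K.trans (K.sym p≈1) (coeff≈ p≈0 k)) (≈ᴾ-refl {[]}))

-- Units of K(X), and the eigenvalues seen in K(X)

module RationalCharacteristic (K : HeytingField c ℓ₁ ℓ₂) where
  open RationalFunctions K
  open FractionField K
  open Degree K
  private
    module K = CommutativeRing (fieldRing K)
    module P = Matrices K[X]
    module F = CommutativeRing fractionRing
    module H = Homomorphism K[X] fractionRing fromPoly fromPoly-isHomomorphism
  open Matrices K⟨X⟩
  open Determinants fractionRing using (f-cong; product-cong)

  sub-nat : ∀ {p u} → fromPoly p ≈ u → ∀ m → fromPoly (p P.- P.nat m) ≈ u - nat m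
  sub-nat {p} {u} p≈u m = F.trans {fromPoly (p P.- P.nat m)} {fromPoly p - fromPoly (P.nat m)} {u - nat m}
    (H.sub-homo p (P.nat m))
    (F.+-cong {fromPoly p} {u} {F.- fromPoly (P.nat m)} {F.- nat m} p≈u
      (F.-‿cong {fromPoly (P.nat m)} {nat m} (H.nat-homo m)))

  -- A fraction built by ring operations carries an unreduced denominator, which obscures whether
  -- its numerator is zero. Comparing it with a polynomial `p` reduces the question to the
  -- coefficients of `p`.
  invertible : ∀ {u} p → fromPoly p ≈ u → p ≉ᴾ [] → Σ[ v ∈ Fraction ] u * v ≈ 1#
  invertible {u} p p≈u p≉0 = reciprocal p p≉0 ,
    F.trans {u * reciprocal p p≉0} {fromPoly p * reciprocal p p≉0} {1#}
      (F.*-congʳ {reciprocal p p≉0} {u} {fromPoly p} (F.sym {fromPoly p} {u} p≈u)) (*-reciprocal p p≉0)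

  -- Characteristic zero enters here, through the constant coefficient; the other two units come
  -- from monic polynomials.
  nat-invertible : CharacteristicZero K → ∀ m → .{{_ : NonZero m}} → Σ[ v ∈ Fraction ] nat m * v ≈ 1#
  nat-invertible char0 m = invertible {nat m} (P.nat m) (H.nat-homo m) λ m≈0 →
    proj₂ (HeytingField.tight K _ _) (K.trans (K.sym (coeff-nat m)) (coeff≈ m≈0 zero)) (char0 m)

  x-nat-nat-invertible : ∀ k l → Σ[ v ∈ Fraction ] (x - nat k - nat l) * v ≈ 1#
  x-nat-nat-invertible k l = invertible {x - nat k - nat l} (X P.- P.nat k P.- P.nat l)
    (sub-nat {X P.- P.nat k} {x - nat k} (sub-nat {X} {x} (F.refl {x}) k) l)
    (monic-≉0 (X P.- P.nat k P.- P.nat l) 1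
      (K.trans (coeff-sub-nat (X P.- P.nat k) l 0) (coeff-sub-nat X k 0)))

  -- The polynomial behind this determinant is monic of degree n. Its inverse turns the adjugate
  -- into the inverse matrix that defines the coronal.
  f-laplacian-invertible : (G : Graph n) → ∀ k → Σ[ v ∈ Fraction ] f (laplacian G) (x - nat k) * v ≈ 1#
  f-laplacian-invertible {n} G k = invertible {f (laplacian G) (x - nat k)} (P.f (P.laplacian G) t)
    (F.trans {fromPoly (P.f (P.laplacian G) t)} {f (laplacian G) (fromPoly t)} {f (laplacian G) (x - nat k)}
      (H.f-laplacian-homo G t)
      (f-cong (laplacian G) {fromPoly t} {x - nat k} (sub-nat {X} {x} (F.refl {x}) k)))
    (monic-≉0 (P.f (P.laplacian G) t) n
      (f-monic (P.laplacian G) (laplacian-constant G) t (λ j → coeff-sub-nat X k (suc j)) (coeff-sub-nat X k 0)))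
    where
    t : Poly
    t = X P.- P.nat k

  -- The hypothesis is an identity in K[X]. Evaluation at `z` is a homomorphism to K(X) that fixes
  -- the integer entries of the Laplacian matrix and sends X to `z`, so the factorisation holds at
  -- every rational function.
  f-laplacian-eigenvalues : (G : Graph n) (μ : Vector K.Carrier n) → LaplacianEigenvalues K G μ →
    ∀ z → f (laplacian G) z ≈ product λ i → z - const (μ i)
  f-laplacian-eigenvalues G μ eigenvalues z = begin
    f (laplacian G) z                         ≈⟨ f-cong (laplacian G) {eval X} {z} eval-X ⟨
    f (laplacian G) (eval X)                  ≈⟨ E.f-laplacian-homo G X ⟨
    eval (P.f (P.laplacian G) X)              ≈⟨ eval-cong eigenvalues ⟩
    eval (P.product λ i → X P.- constᴾ (μ i)) ≈⟨ E.product-homo (λ i → X P.- constᴾ (μ i)) ⟩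
    product (λ i → eval (X P.- constᴾ (μ i))) ≈⟨ product-cong factor ⟩
    product (λ i → z - const (μ i))           ∎
    where
    open Evaluation K fractionRing const const-isHomomorphism z
    module E = Homomorphism K[X] fractionRing eval eval-isHomomorphism
    open import Relation.Binary.Reasoning.Setoid F.setoid

    factor : ∀ i → eval (X P.- constᴾ (μ i)) ≈ z - const (μ i)
    factor i = F.trans {eval (X P.- constᴾ (μ i))} {eval X - eval (constᴾ (μ i))} {z - const (μ i)}
      (E.sub-homo X (constᴾ (μ i)))
      (F.+-cong {eval X} {z} {F.- eval (constᴾ (μ i))} {F.- const (μ i)} eval-X
        (F.-‿cong {eval (constᴾ (μ i))} {const (μ i)} (eval-constᴾ (μ i))))

theorem1 : ∀ {c ℓ₁ ℓ₂} (K : HeytingField c ℓ₁ ℓ₂) → CharacteristicZero K →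
  ∀ (n₁ n₂ r₁ r₂ : ℕ) → .{{_ : NonZero n₂}} →
  (G₁ : Graph n₁) (G₂ : Graph n₂) → Regular r₁ G₁ → Regular r₂ G₂ →
  (μ : Vector (HeytingField.Carrier K) n₁) → LaplacianEigenvalues K G₁ μ →
  let open RationalFunctions K
      open Matrices K⟨X⟩
  in
  Σ[ inv ∈ Invertibleᴹ (scalar (x - nat n₂) -ᴹ laplacian G₂) ]
    f (laplacian (G₁ ⊛ G₂)) x
      ≈ (x - nat (r₁ ℕ.* n₂) - nat n₂) ^ (n₁ ℕ.* (n₂ ∸ 1))
        * f (laplacian G₂) (x - nat n₂) ^ n₁
        * product (λ i → x - nat n₂ - nat n₂ * const (μ i)
                           - nat n₂ * coronal G₂ (x - nat n₂) inv)
theorem1 K char0 n₁ n₂ r₁ r₂ G₁ G₂ regular₁ _ μ eigenvalues =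
  inv , product-formula r₁ regular₁ x (proj₁ inv) (proj₁ (proj₂ inv)) {proj₁ t⁻¹} {proj₁ n⁻¹}
          (proj₂ t⁻¹) (proj₂ n⁻¹) (λ i → const (μ i)) (f-laplacian-eigenvalues G₁ μ eigenvalues)
  where
  open RationalFunctions K
  open Matrices K⟨X⟩
  open RationalCharacteristic K
  open Determinants (FractionField.fractionRing K)
  open ProductGraph G₁ G₂ using (product-formula)

  -- The three units: the first cancels the power of t left by Sylvester's identity, the second
  -- divides by n₂ in the eigenvalue step, and the third is the determinant behind the coronal.
  t⁻¹ = x-nat-nat-invertible (r₁ ℕ.* n₂) n₂
  n⁻¹ = nat-invertible char0 n₂
  f⁻¹ = f-laplacian-invertible G₂ n₂

  inv : Invertibleᴹ (scalar (x - nat n₂) -ᴹ laplacian G₂)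
  inv = laplacian-invertible G₂ (x - nat n₂) {proj₁ f⁻¹} (proj₂ f⁻¹)
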